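{- There is an oracle $A\in 2^\omega$ and some $X\in 2^\omega$ with $X\leq_{\omega_1^{ck}T}A$ such that for no everywhere consistent higher Turing functional $\Phi$ do we have $\Phi(A)=X$.
   Context: A higher Turing functional is a $\Pi^1_1$ (lightface) set $\Phi\subseteq 2^{<\omega}\times 2^{<\omega}$. It is consistent on $B\in 2^\omega$ if any two strings $\sigma,\sigma'$ for which there are finite initial segments $\tau,\tau'$ of $B$ with $(\tau,\sigma),(\tau',\sigma')\in\Phi$ are comparable. It is everywhere consistent if it is consistent on every $B\in 2^\omega$. For $B,Y\in 2^\omega$, $\Phi(B)=Y$ means that $\Phi$ is consistent on $B$ and the union of all $\sigma$ such that $(\tau,\sigma)\in\Phi$ for some finite initial segment $\tau$ of $B$ is $Y$. $Y\leq_{\omega_1^{ck}T}B$ ($Y$ is higher $B$-computable) means that $\Phi(B)=Y$ for some higher Turing functional $\Phi$ (not necessarily everywhere consistent). -}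

module Defs where

open import Data.Bool.Base using (Bool; if_then_else_)
open import Data.Empty using (⊥)
open import Data.Fin.Base using (Fin; toℕ)
open import Data.List.Base using (List; length; lookup; foldl; applyUpTo)
open import Data.List.Relation.Binary.Prefix.Heterogeneous using (Prefix)
open import Data.Nat.Base using (ℕ; zero; suc; _+_; _*_)
open import Data.Product.Base using (Σ-syntax; ∃-syntax; _×_)
open import Data.Sum.Base using (_⊎_)
open import Data.Vec.Base as Vec using (Vec; []; _∷_)
open import Function.Bundles using (_⇔_)
open import Level using (0ℓ) renaming (suc to lsuc)
open import Relation.Binary.Core using (Rel)
open import Relation.Binary.PropositionalEquality using (_≡_)

-- Arithmetical formulas with k free function variables (ranging over ℕ → ℕ)
-- and n free number variables in de Bruijn style. Only number quantifiers
-- occur.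

infixl 7 _*ᵗ_
infixl 6 _+ᵗ_
infix  5 _≈ᶠ_
infixr 4 _∧ᶠ_
infixr 3 _∨ᶠ_
infixr 2 _⇒ᶠ_

data Term (k n : ℕ) : Set where
  var         : Fin n → Term k n
  app         : Fin k → Term k n → Term k n
  zeroᵗ       : Term k n
  sucᵗ        : Term k n → Term k n
  _+ᵗ_ _*ᵗ_   : Term k n → Term k n → Term k n

data Arithmetical (k n : ℕ) : Set where
  _≈ᶠ_             : Term k n → Term k n → Arithmetical k n
  ⊥ᶠ               : Arithmetical k n
  _∧ᶠ_ _∨ᶠ_ _⇒ᶠ_   : Arithmetical k n → Arithmetical k n → Arithmetical k n
  ∀ᶠ ∃ᶠ            : Arithmetical k (suc n) → Arithmetical k n

⟦_⟧ᵗ : ∀ {k n} → Term k n → Vec (ℕ → ℕ) k → Vec ℕ n → ℕ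
⟦ var i   ⟧ᵗ fs xs = Vec.lookup xs i
⟦ app i t ⟧ᵗ fs xs = Vec.lookup fs i (⟦ t ⟧ᵗ fs xs)
⟦ zeroᵗ   ⟧ᵗ fs xs = zero
⟦ sucᵗ t  ⟧ᵗ fs xs = suc (⟦ t ⟧ᵗ fs xs)
⟦ s +ᵗ t  ⟧ᵗ fs xs = ⟦ s ⟧ᵗ fs xs + ⟦ t ⟧ᵗ fs xs
⟦ s *ᵗ t  ⟧ᵗ fs xs = ⟦ s ⟧ᵗ fs xs * ⟦ t ⟧ᵗ fs xs

⟦_⟧ : ∀ {k n} → Arithmetical k n → Vec (ℕ → ℕ) k → Vec ℕ n → Set
⟦ s ≈ᶠ t ⟧ fs xs = ⟦ s ⟧ᵗ fs xs ≡ ⟦ t ⟧ᵗ fs xs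
⟦ ⊥ᶠ     ⟧ fs xs = ⊥
⟦ φ ∧ᶠ ψ ⟧ fs xs = ⟦ φ ⟧ fs xs × ⟦ ψ ⟧ fs xs
⟦ φ ∨ᶠ ψ ⟧ fs xs = ⟦ φ ⟧ fs xs ⊎ ⟦ ψ ⟧ fs xs
⟦ φ ⇒ᶠ ψ ⟧ fs xs = ⟦ φ ⟧ fs xs → ⟦ ψ ⟧ fs xs
⟦ ∀ᶠ φ   ⟧ fs xs = (x : ℕ) → ⟦ φ ⟧ fs (x ∷ xs)
⟦ ∃ᶠ φ   ⟧ fs xs = Σ[ x ∈ ℕ ] ⟦ φ ⟧ fs (x ∷ xs)

2^<ω : Set
2^<ω = List Bool

2^ω : Set
2^ω = ℕ → Bool

-- The position of a string in the length-lexicographic order; this is the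
-- usual computable bijection between 2^<ω and ℕ.
code : 2^<ω → ℕ
code = foldl (λ c b → 2 * c + (if b then 2 else 1)) 0

-- Lightface Π¹₁: defined by ∀f₁…∀fₖ θ with θ arithmetical. Formulas have no
-- function or number parameters besides the codes of the two strings.
IsΠ¹₁ : Rel 2^<ω 0ℓ → Set
IsΠ¹₁ Φ =
  Σ[ k ∈ ℕ ] Σ[ θ ∈ Arithmetical k 2 ]
    (∀ τ σ → Φ τ σ ⇔ ((fs : Vec (ℕ → ℕ) k) → ⟦ θ ⟧ fs (code τ ∷ code σ ∷ [])))

record HigherTuringFunctional : Set (lsuc 0ℓ) where
  field
    Graph : Rel 2^<ω 0ℓ
    isΠ¹₁ : IsΠ¹₁ Graph

open HigherTuringFunctional public

infix 4 _≺_ _at_is_ _⟨_⟩≐_ _≤ω₁ᶜᵏT_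

_≺_ : 2^<ω → 2^ω → Set
τ ≺ B = τ ≡ applyUpTo B (length τ)

Comparable : Rel 2^<ω 0ℓ
Comparable σ σ′ = Prefix _≡_ σ σ′ ⊎ Prefix _≡_ σ′ σ

ConsistentOn : HigherTuringFunctional → 2^ω → Set
ConsistentOn Φ B =
  ∀ τ τ′ σ σ′ → τ ≺ B → τ′ ≺ B → Graph Φ τ σ → Graph Φ τ′ σ′ → Comparable σ σ′

EverywhereConsistent : HigherTuringFunctional → Set
EverywhereConsistent Φ = (B : 2^ω) → ConsistentOn Φ B

-- Strings as sets of (position, bit) pairs, so that unions make sense.
_at_is_ : 2^<ω → ℕ → Bool → Set
σ at n is b = Σ[ i ∈ Fin (length σ) ] (toℕ i ≡ n × lookup σ i ≡ b)

UnionIs : HigherTuringFunctional → 2^ω → 2^ω → Set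
UnionIs Φ B Y =
  ∀ n b → Y n ≡ b ⇔ (∃[ τ ] ∃[ σ ] (τ ≺ B × Graph Φ τ σ × σ at n is b))

_⟨_⟩≐_ : HigherTuringFunctional → 2^ω → 2^ω → Set
Φ ⟨ B ⟩≐ Y = ConsistentOn Φ B × UnionIs Φ B Y

_≤ω₁ᶜᵏT_ : 2^ω → 2^ω → Set (lsuc 0ℓ)
Y ≤ω₁ᶜᵏT B = Σ[ Φ ∈ HigherTuringFunctional ] (Φ ⟨ B ⟩≐ Y)

{-# OPTIONS --safe #-}
module Submission where

open import Axiom.ExcludedMiddle using (ExcludedMiddle)
open import Data.Product.Base using (Σ-syntax; _×_)
open import Level using (0ℓ)
open import Relation.Nullary.Negation.Core using (¬_)
open import Defs

open import Data.Bool.Base using (Bool; true; false; if_then_else_)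
open import Data.Empty using (⊥; ⊥-elim)
open import Data.Fin.Base using (Fin; zero; suc; toℕ)
open import Data.Fin using (#_)
open import Data.List.Base using (List; []; _∷_; _∷ʳ_; length; applyUpTo)
open import Data.List.Properties using (length-++; foldl-∷ʳ; applyUpTo-∷ʳ; length-applyUpTo)
open import Data.List.Relation.Binary.Prefix.Heterogeneous using (Prefix; []; _∷_)
open import Data.List.Reverse using (Reverse; reverseView; []; _∶_∶ʳ_)
open import Data.Nat.Base
open import Data.Nat.Properties
open import Data.Product.Base using (_,_; proj₁; proj₂)
open import Data.Sum.Base using (_⊎_; inj₁; inj₂)
open import Data.Vec.Base as Vec using (Vec; []; _∷_)
open import Data.Vec.Properties using (lookup∘tabulate)
open import Function.Base using (_∘_; id)
open import Function.Bundles using (_⇔_; mk⇔; Equivalence)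
open import Relation.Binary.Definitions using (tri<; tri≈; tri>)
open import Relation.Binary.PropositionalEquality
open import Relation.Nullary.Decidable.Core using (Dec; yes; no; does; decidable-stable)

open Equivalence using (to; from)

-- A is split into columns, and X(k) = 1 will mean that column k of A is empty from
-- some stage on. At stage k there are a finite part τ of A and σ = X|k, where A must
-- put no new 1 in the columns i with σ(i) = 1. Let Ψ be the k-th Π¹₁ functional and
-- call (τ , σ) forced if every τ₁ ⊇ τ respecting the columns of σ and leaving column k
-- empty has an extension τ₂, respecting the columns of σ only, on which Ψ answers 0
-- at k.
--   * If it is forced, keep column k empty and put X(k) = 1. If Ψ(A) = X, some finite
--     part of A makes Ψ answer 1 at k, and it has an extension making Ψ answer 0, so
--     Ψ is not consistent everywhere.
--   * Otherwise take a counterexample τ₁, add a 1 to column k, and put X(k) = 0; then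
--     Ψ never answers 0 at k on A.
-- Being forced is Π¹₁, so the reachable pairs (τ , σ) form a Π¹₁ set. It is not
-- everywhere consistent, but on A the first new 1 in column k, if any, determines
-- which case was taken; hence it computes X from A.

-- A pairing function

opaque
  -- A polynomial, so that pairing is a term of the formula language. It is injective but not onto.
  pair : ℕ → ℕ → ℕ
  pair a b = (a + b) * (a + b) + a

  pair-def : ∀ a b → pair a b ≡ (a + b) * (a + b) + a
  pair-def a b = refl

private
  square+<square : ∀ {s s′ a} → s < s′ → a ≤ s → s * s + a < s′ * s′
  square+<square {s} {s′} {a} s<s′ a≤s = begin-strict
    s * s + a      ≤⟨ +-monoʳ-≤ (s * s) a≤s ⟩
    s * s + s      ≡⟨ +-comm (s * s) s ⟩
    suc s * s      <⟨ *-monoʳ-< (suc s) (n<1+n s) ⟩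
    suc s * suc s  ≤⟨ *-mono-≤ s<s′ s<s′ ⟩
    s′ * s′        ∎
    where open ≤-Reasoning

  -- Pairs with sum s have codes from s² to s² + s, which is below (s + 1)². So different sums give
  -- disjoint intervals.
  pair-sum-≮ : ∀ {a b c d} → pair a b ≡ pair c d → ¬ (a + b < c + d)
  pair-sum-≮ {a} {b} {c} {d} eq a+b<c+d = <-irrefl eq (begin-strict
    pair a b                     ≡⟨ pair-def a b ⟩
    (a + b) * (a + b) + a        <⟨ square+<square a+b<c+d (m≤m+n a b) ⟩
    (c + d) * (c + d)            ≤⟨ m≤m+n _ c ⟩
    (c + d) * (c + d) + c        ≡⟨ pair-def c d ⟨
    pair c d                     ∎)
    where open ≤-Reasoning

pair-injective : ∀ {a b c d} → pair a b ≡ pair c d → a ≡ c × b ≡ d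
pair-injective {a} {b} {c} {d} eq with <-cmp (a + b) (c + d)
... | tri< lt _ _ = ⊥-elim (pair-sum-≮ {a} {b} eq lt)
... | tri> _ _ gt = ⊥-elim (pair-sum-≮ {c} {d} (sym eq) gt)
... | tri≈ _ s≡ _ = a≡c , +-cancelˡ-≡ a b d (trans s≡ (cong (_+ d) (sym a≡c)))
  where
  a≡c : a ≡ c
  a≡c = +-cancelˡ-≡ ((a + b) * (a + b)) a c (begin
    (a + b) * (a + b) + a  ≡⟨ pair-def a b ⟨
    pair a b               ≡⟨ eq ⟩
    pair c d               ≡⟨ pair-def c d ⟩
    (c + d) * (c + d) + c  ≡⟨ cong (λ s → s * s + c) s≡ ⟨
    (a + b) * (a + b) + c  ∎)
    where open ≡-Reasoning

private
  n≤n*n : ∀ n → n ≤ n * n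
  n≤n*n zero    = z≤n
  n≤n*n (suc n) = m≤m*n (suc n) (suc n)

m≤pair : ∀ m n → m ≤ pair m n
m≤pair m n = ≤-trans (m≤n+m m _) (≤-reflexive (sym (pair-def m n)))

n≤pair : ∀ m n → n ≤ pair m n
n≤pair m n = begin
  n                      ≤⟨ m≤n+m n m ⟩
  m + n                  ≤⟨ n≤n*n (m + n) ⟩
  (m + n) * (m + n)      ≤⟨ m≤m+n _ m ⟩
  (m + n) * (m + n) + m  ≡⟨ pair-def m n ⟨
  pair m n               ∎
  where open ≤-Reasoning

-- Strictness needs a nonzero first component. This is why the tag in `node` is a successor: parts
-- of an expression then have smaller codes.
n<pair-suc : ∀ m n → n < pair (suc m) n
n<pair-suc m n = begin-strict
  n                              <⟨ n<1+n n ⟩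
  suc n                          ≤⟨ s≤s (m≤n+m n m) ⟩
  suc m + n                      ≤⟨ n≤n*n (suc m + n) ⟩
  (suc m + n) * (suc m + n)      ≤⟨ m≤m+n _ (suc m) ⟩
  (suc m + n) * (suc m + n) + suc m ≡⟨ pair-def (suc m) n ⟨
  pair (suc m) n                 ∎
  where open ≤-Reasoning

-- Coded expressions and a universal Π¹₁ relation

-- Expressions are coded by nested nodes and evaluated in an environment
-- pair x₀ (pair x₁ …). A truth value is a number, 0 meaning true, so that + and *
-- also serve as conjunction and disjunction.

node : ℕ → ℕ → ℕ → ℕ
node j a b = pair (suc j) (pair a b)

pattern topᵒ   = 0
pattern shiftᵒ = 1
pattern zeroᵒ  = 2
pattern sucᵒ   = 3
pattern addᵒ   = 4
pattern mulᵒ   = 5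
pattern eqᵒ    = 6
pattern existsᵒ = 7
pattern applyᵒ = 8

-- Tarski's clauses for satisfaction relative to `f`: `T (pair c e)` is the value of `c` in `e`.
-- Truth of all arithmetical formulas is not arithmetical, but these clauses for a given `T` are.
IsEvaluation : (ℕ → ℕ) → (ℕ → ℕ) → Set
IsEvaluation f T = ∀ a b x e →
    T (pair (node topᵒ a b) (pair x e)) ≡ x
  × T (pair (node shiftᵒ a b) (pair x e)) ≡ T (pair a e)
  × T (pair (node zeroᵒ a b) e) ≡ 0
  × T (pair (node sucᵒ a b) e) ≡ suc (T (pair a e))
  × T (pair (node addᵒ a b) e) ≡ T (pair a e) + T (pair b e)
  × T (pair (node mulᵒ a b) e) ≡ T (pair a e) * T (pair b e)
  × (T (pair a e) ≡ T (pair b e) → T (pair (node eqᵒ a b) e) ≡ 0)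
  × (T (pair a e) ≢ T (pair b e) → T (pair (node eqᵒ a b) e) ≡ 1)
  × (Σ[ y ∈ ℕ ] T (pair a (pair y e)) ≡ 0 → T (pair (node existsᵒ a b) e) ≡ 0)
  × (T (pair (node existsᵒ a b) e) ≡ 0 → Σ[ y ∈ ℕ ] T (pair a (pair y e)) ≡ 0)
  × T (pair (node applyᵒ a b) e) ≡ f (T (pair a e))

-- A universal Π¹₁ relation: k codes a formula, true or not at (a , b) depending
-- on the function f, and T is determined by f on all codes of formulas.
Universal : ℕ → ℕ → ℕ → Set
Universal k a b =
  ∀ f T → IsEvaluation f T → T (pair k (pair a (pair b 0))) ≡ 0

-- Finite conditions, forcing and reachable pairs

-- val is also the digit by which b contributes to code; 0 stands for a position
-- beyond the end of a string.
val : Bool → ℕ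
val b = if b then 2 else 1

bit : 2^<ω → ℕ → ℕ
bit []      _       = 0
bit (b ∷ τ) zero    = val b
bit (b ∷ τ) (suc n) = bit τ n

bits : 2^ω → ℕ → ℕ
bits A n = val (A n)

Pre : (ℕ → ℕ) → (ℕ → ℕ) → Set
Pre t t′ = ∀ n → t n ≢ 0 → t′ n ≡ t n

-- Column i consists of the positions pair i m. For s the bits of σ, the bits of t′
-- beyond t vanish on every column i with σ(i) = 1.
Avoids : (ℕ → ℕ) → (ℕ → ℕ) → (ℕ → ℕ) → Set
Avoids s t t′ = ∀ i m → s i ≡ 2 → t (pair i m) ≡ 0 → t′ (pair i m) ≢ 2

Ext : (ℕ → ℕ) → (ℕ → ℕ) → (ℕ → ℕ) → Set
Ext s t t′ = Pre t t′ × Avoids s t t′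

-- Both the index of the functional and its argument are `length σ`. As `val false` is 1, the bit 1
-- of `ρ` is the answer 0. New 1s in column `length σ` are allowed.
Answered : 2^<ω → 2^<ω → Set
Answered σ τ₁ =
  Σ[ τ₂ ∈ 2^<ω ] Σ[ υ ∈ 2^<ω ] Σ[ ρ ∈ 2^<ω ]
    (Ext (bit σ) (bit τ₁) (bit τ₂) × Pre (bit υ) (bit τ₂) ×
     bit ρ (length σ) ≡ 1 × Universal (length σ) (code υ) (code ρ))

-- With k = length σ: the k-th functional can be driven to answer 0 at k after any
-- τ₁ that looks as if column k were empty beyond τ.
Forces : 2^<ω → 2^<ω → Set
Forces τ σ = ∀ τ₁ → Ext (bit (σ ∷ʳ true)) (bit τ) (bit τ₁) → Answered σ τ₁

-- `Reach` and `Forces` occur only positively in the premises. Instead of the failure of `Forces`, a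
-- Σ¹₁ condition, `exit` asks for a new 1 in column `length σ`: the appended bit stands at position
-- `length τ′`.
data Reach : 2^<ω → 2^<ω → Set where
  start : Reach [] []
  stay  : ∀ {τ σ} → Reach τ σ → Forces τ σ → Reach τ (σ ∷ʳ true)
  exit  : ∀ {τ σ} τ′ m → Reach τ σ →
          Ext (bit (σ ∷ʳ true)) (bit τ) (bit τ′) →
          length τ′ ≡ pair (length σ) m →
          Reach (τ′ ∷ʳ true) (σ ∷ʳ false)

-- The same notions on codes of strings. Recursive functions, the closed set R and
-- the refutations of Universal become universally quantified function variables:
-- in ForcesCode the quantifier over (f , T) inside Universal is moved in front of
-- ∀ t₁ ∃ t₂ u r by letting (f , T) depend on the code of (length σ , υ , ρ).

IsStringCoding : (ℕ → ℕ) → (ℕ → ℕ) → Set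
IsStringCoding L H =
    L 0 ≡ 0 × (∀ i → H (pair 0 i) ≡ 0)
  × (∀ c → L (2 * c + 1) ≡ suc (L c) × L (2 * c + 2) ≡ suc (L c)
         × H (pair (2 * c + 1) (L c)) ≡ 1 × H (pair (2 * c + 2) (L c)) ≡ 2
         × (∀ i → i ≢ L c → H (pair (2 * c + 1) i) ≡ H (pair c i)
                          × H (pair (2 * c + 2) i) ≡ H (pair c i)))

section : (ℕ → ℕ) → ℕ → ℕ → ℕ
section F p x = F (pair p x)

ForcesCode : (T L H : ℕ → ℕ) → ℕ → ℕ → Set
ForcesCode T L H t s =
  ∀ t₁ → Ext (section H (2 * s + 2)) (section H t) (section H t₁) →
  Σ[ t₂ ∈ ℕ ] Σ[ u ∈ ℕ ] Σ[ r ∈ ℕ ]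
    (Ext (section H s) (section H t₁) (section H t₂) ×
     Pre (section H u) (section H t₂) × H (pair r (L s)) ≡ 1 ×
     T (pair (pair (L s) (pair u r)) (pair (L s) (pair u (pair r 0)))) ≡ 0)

-- Reach is the least relation closed under its rules; R n ≡ 0 codes membership.
ReachCode : (F T R L H : ℕ → ℕ) → ℕ → ℕ → Set
ReachCode F T R L H t₀ s₀ =
  (∀ p → IsEvaluation (section F p) (section T p)) →
  IsStringCoding L H →
  R (pair 0 0) ≡ 0 →
  (∀ t s → R (pair t s) ≡ 0 → ForcesCode T L H t s → R (pair t (2 * s + 2)) ≡ 0) →
  (∀ t s t′ m → R (pair t s) ≡ 0 →
    Ext (section H (2 * s + 2)) (section H t) (section H t′) →
    L t′ ≡ pair (L s) m → R (pair (2 * t′ + 2) (2 * s + 1)) ≡ 0) →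
  R (pair t₀ s₀) ≡ 0

-- Reachability on codes as an arithmetical formula

module Formula where
  infix 5 _≉ᶠ_

  weaken : ∀ {k n} → Term k n → Term k (suc n)
  weaken (var i)   = var (suc i)
  weaken (app i t) = app i (weaken t)
  weaken zeroᵗ     = zeroᵗ
  weaken (sucᵗ t)  = sucᵗ (weaken t)
  weaken (s +ᵗ t)  = weaken s +ᵗ weaken t
  weaken (s *ᵗ t)  = weaken s *ᵗ weaken t

  num : ∀ {k n} → ℕ → Term k n
  num zero    = zeroᵗ
  num (suc m) = sucᵗ (num m)

  pairᵗ : ∀ {k n} → Term k n → Term k n → Term k n
  pairᵗ s t = (s +ᵗ t) *ᵗ (s +ᵗ t) +ᵗ s

  nodeᵗ : ∀ {k n} → ℕ → Term k n → Term k n → Term k n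
  nodeᵗ j s t = pairᵗ (num (suc j)) (pairᵗ s t)

  _≉ᶠ_ : ∀ {k n} → Term k n → Term k n → Arithmetical k n
  s ≉ᶠ t = s ≈ᶠ t ⇒ᶠ ⊥ᶠ

  Fᵗ Tᵗ Rᵗ Hᵗ : ∀ {n} → Term 5 n → Term 5 n → Term 5 n
  Fᵗ p x = app (# 0) (pairᵗ p x)
  Tᵗ p x = app (# 1) (pairᵗ p x)
  Rᵗ t s = app (# 2) (pairᵗ t s)
  Hᵗ c i = app (# 4) (pairᵗ c i)

  Lᵗ : ∀ {n} → Term 5 n → Term 5 n
  Lᵗ c = app (# 3) c

  snoc : ∀ {n} → Bool → Term 5 n → Term 5 n
  snoc b c = num 2 *ᵗ c +ᵗ num (val b)

  evaluationsᶠ : Arithmetical 5 2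
  evaluationsᶠ = ∀ᶠ (∀ᶠ (∀ᶠ (∀ᶠ (∀ᶠ (
        T (nodeᵗ topᵒ a b) (pairᵗ x e) ≈ᶠ x
     ∧ᶠ T (nodeᵗ shiftᵒ a b) (pairᵗ x e) ≈ᶠ T a e
     ∧ᶠ T (nodeᵗ zeroᵒ a b) e ≈ᶠ zeroᵗ
     ∧ᶠ T (nodeᵗ sucᵒ a b) e ≈ᶠ sucᵗ (T a e)
     ∧ᶠ T (nodeᵗ addᵒ a b) e ≈ᶠ T a e +ᵗ T b e
     ∧ᶠ T (nodeᵗ mulᵒ a b) e ≈ᶠ T a e *ᵗ T b e
     ∧ᶠ (T a e ≈ᶠ T b e ⇒ᶠ T (nodeᵗ eqᵒ a b) e ≈ᶠ zeroᵗ)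
     ∧ᶠ (T a e ≉ᶠ T b e ⇒ᶠ T (nodeᵗ eqᵒ a b) e ≈ᶠ num 1)
     ∧ᶠ (∃y ⇒ᶠ T (nodeᵗ existsᵒ a b) e ≈ᶠ zeroᵗ)
     ∧ᶠ (T (nodeᵗ existsᵒ a b) e ≈ᶠ zeroᵗ ⇒ᶠ ∃y)
     ∧ᶠ T (nodeᵗ applyᵒ a b) e ≈ᶠ Fᵗ p (T a e))))))
    where
    p a b x e : Term 5 7
    p = var (# 4)
    a = var (# 3)
    b = var (# 2)
    x = var (# 1)
    e = var (# 0)
    T : Term 5 7 → Term 5 7 → Term 5 7
    T c d = Tᵗ p (pairᵗ c d)
    ∃y : Arithmetical 5 7
    ∃y = ∃ᶠ (Tᵗ (weaken p) (pairᵗ (weaken a) (pairᵗ (var (# 0)) (weaken e))) ≈ᶠ zeroᵗ)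

  codingᶠ : Arithmetical 5 2
  codingᶠ =
       Lᵗ zeroᵗ ≈ᶠ zeroᵗ
    ∧ᶠ ∀ᶠ (Hᵗ zeroᵗ (var (# 0)) ≈ᶠ zeroᵗ)
    ∧ᶠ ∀ᶠ (Lᵗ (snoc false c) ≈ᶠ sucᵗ (Lᵗ c)
        ∧ᶠ Lᵗ (snoc true c) ≈ᶠ sucᵗ (Lᵗ c)
        ∧ᶠ Hᵗ (snoc false c) (Lᵗ c) ≈ᶠ num 1
        ∧ᶠ Hᵗ (snoc true c) (Lᵗ c) ≈ᶠ num 2
        ∧ᶠ ∀ᶠ (i ≉ᶠ Lᵗ (weaken c) ⇒ᶠ
                 Hᵗ (snoc false (weaken c)) i ≈ᶠ Hᵗ (weaken c) i
              ∧ᶠ Hᵗ (snoc true (weaken c)) i ≈ᶠ Hᵗ (weaken c) i))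
    where
    c : Term 5 3
    c = var (# 0)
    i : Term 5 4
    i = var (# 0)

  preᶠ : ∀ {n} → Term 5 n → Term 5 n → Arithmetical 5 n
  preᶠ t t′ = ∀ᶠ (Hᵗ (weaken t) i ≉ᶠ zeroᵗ ⇒ᶠ Hᵗ (weaken t′) i ≈ᶠ Hᵗ (weaken t) i)
    where
    i = var (# 0)

  extᶠ : ∀ {n} → Term 5 n → Term 5 n → Term 5 n → Arithmetical 5 n
  extᶠ s t t′ = preᶠ t t′ ∧ᶠ ∀ᶠ (∀ᶠ (
    Hᵗ (up s) i ≈ᶠ num 2 ⇒ᶠ Hᵗ (up t) (pairᵗ i m) ≈ᶠ zeroᵗ ⇒ᶠ
    Hᵗ (up t′) (pairᵗ i m) ≉ᶠ num 2))
    where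
    up = λ c → weaken (weaken c)
    i = var (# 1)
    m = var (# 0)

  forcesᶠ : Arithmetical 5 4
  forcesᶠ = ∀ᶠ (
    extᶠ (snoc true (var (# 1))) (var (# 2)) (var (# 0)) ⇒ᶠ
    ∃ᶠ (∃ᶠ (∃ᶠ (
         extᶠ s t₁ t₂ ∧ᶠ preᶠ u t₂ ∧ᶠ Hᵗ r (Lᵗ s) ≈ᶠ num 1
      ∧ᶠ Tᵗ (pairᵗ (Lᵗ s) (pairᵗ u r)) (pairᵗ (Lᵗ s) (pairᵗ u (pairᵗ r zeroᵗ))) ≈ᶠ zeroᵗ))))
    where
    s t₁ t₂ u r : Term 5 8
    s  = var (# 4)
    t₁ = var (# 3)
    t₂ = var (# 2)
    u  = var (# 1)
    r  = var (# 0)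

  stayᶠ : Arithmetical 5 2
  stayᶠ = ∀ᶠ (∀ᶠ (Rᵗ t s ≈ᶠ zeroᵗ ⇒ᶠ forcesᶠ ⇒ᶠ Rᵗ t (snoc true s) ≈ᶠ zeroᵗ))
    where
    t s : Term 5 4
    t = var (# 1)
    s = var (# 0)

  exitᶠ : Arithmetical 5 2
  exitᶠ = ∀ᶠ (∀ᶠ (∀ᶠ (∀ᶠ (
    Rᵗ t s ≈ᶠ zeroᵗ ⇒ᶠ extᶠ (snoc true s) t t′ ⇒ᶠ Lᵗ t′ ≈ᶠ pairᵗ (Lᵗ s) m ⇒ᶠ
    Rᵗ (snoc true t′) (snoc false s) ≈ᶠ zeroᵗ))))
    where
    t s t′ m : Term 5 6
    t  = var (# 3)
    s  = var (# 2)
    t′ = var (# 1)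
    m  = var (# 0)

  reachᶠ : Arithmetical 5 2
  reachᶠ = evaluationsᶠ ⇒ᶠ codingᶠ ⇒ᶠ Rᵗ zeroᵗ zeroᵗ ≈ᶠ zeroᵗ ⇒ᶠ stayᶠ ⇒ᶠ exitᶠ ⇒ᶠ
           Rᵗ (var (# 0)) (var (# 1)) ≈ᶠ zeroᵗ

  opaque
    unfolding pair

    -- The formula follows `ReachCode` clause by clause, with function variables in the order F, T,
    -- R, L, H. Once `pair` is unfolded, both sides are the same by computation.
    reachᶠ-semantics : ∀ F T R L H t s →
      ⟦ reachᶠ ⟧ (F ∷ T ∷ R ∷ L ∷ H ∷ []) (t ∷ s ∷ []) ≡ ReachCode F T R L H t s
    reachᶠ-semantics F T R L H t s = refl

-- Encoding of arithmetical formulas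

env : ∀ {n} → Vec ℕ n → ℕ
env []       = 0
env (x ∷ xs) = pair x (env xs)

module Encoding where

  addᶜ mulᶜ eqᶜ pairᶜ : ℕ → ℕ → ℕ
  addᶜ = node addᵒ
  mulᶜ = node mulᵒ
  eqᶜ  = node eqᵒ
  pairᶜ a b = addᶜ (mulᶜ (addᶜ a b) (addᶜ a b)) a

  zeroᶜ : ℕ
  zeroᶜ = node zeroᵒ 0 0

  sucᶜ existsᶜ negᶜ : ℕ → ℕ
  sucᶜ a    = node sucᵒ a 0
  existsᶜ a = node existsᵒ a 0
  -- The inner equation reduces every nonzero value to exactly 1, so comparison with 1 negates.
  negᶜ a    = eqᶜ (eqᶜ a zeroᶜ) (sucᶜ zeroᶜ)

  numᶜ : ℕ → ℕ
  numᶜ zero    = zeroᶜ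
  numᶜ (suc n) = sucᶜ (numᶜ n)

  varᶜ : ∀ {n} → Fin n → ℕ
  varᶜ zero    = node topᵒ 0 0
  varᶜ (suc i) = node shiftᵒ (varᶜ i) 0

  termᶜ : ∀ {k n} → Term k n → ℕ
  termᶜ (var i)   = varᶜ i
  -- The single function of an evaluation stands for all k function variables; the i-th one is its
  -- section at `toℕ i`.
  termᶜ (app i t) = node applyᵒ (pairᶜ (numᶜ (toℕ i)) (termᶜ t)) 0
  termᶜ zeroᵗ     = zeroᶜ
  termᶜ (sucᵗ t)  = sucᶜ (termᶜ t)
  termᶜ (s +ᵗ t)  = addᶜ (termᶜ s) (termᶜ t)
  termᶜ (s *ᵗ t)  = mulᶜ (termᶜ s) (termᶜ t)

  formulaᶜ : ∀ {k n} → Arithmetical k n → ℕ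
  formulaᶜ (s ≈ᶠ t) = eqᶜ (termᶜ s) (termᶜ t)
  formulaᶜ ⊥ᶠ       = sucᶜ zeroᶜ
  formulaᶜ (φ ∧ᶠ ψ) = addᶜ (formulaᶜ φ) (formulaᶜ ψ)
  formulaᶜ (φ ∨ᶠ ψ) = mulᶜ (formulaᶜ φ) (formulaᶜ ψ)
  formulaᶜ (φ ⇒ᶠ ψ) = mulᶜ (negᶜ (formulaᶜ φ)) (formulaᶜ ψ)
  formulaᶜ (∀ᶠ φ)   = negᶜ (existsᶜ (negᶜ (formulaᶜ φ)))
  formulaᶜ (∃ᶠ φ)   = existsᶜ (formulaᶜ φ)

  module Correct {f T : ℕ → ℕ} (ev : IsEvaluation f T) where

    value : ℕ → ℕ → ℕ
    value c e = T (pair c e)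

    True : ℕ → ℕ → Set
    True c e = value c e ≡ 0

    eval-top : ∀ a b x e → value (node topᵒ a b) (pair x e) ≡ x
    eval-top a b x e = let p , _ = ev a b x e in p

    eval-shift : ∀ a b x e → value (node shiftᵒ a b) (pair x e) ≡ value a e
    eval-shift a b x e = let _ , p , _ = ev a b x e in p

    eval-zero : ∀ e → value zeroᶜ e ≡ 0
    eval-zero e = let _ , _ , p , _ = ev 0 0 0 e in p

    eval-suc : ∀ a e → value (sucᶜ a) e ≡ suc (value a e)
    eval-suc a e = let _ , _ , _ , p , _ = ev a 0 0 e in p

    eval-add : ∀ a b e → value (addᶜ a b) e ≡ value a e + value b e
    eval-add a b e = let _ , _ , _ , _ , p , _ = ev a b 0 e in p

    eval-mul : ∀ a b e → value (mulᶜ a b) e ≡ value a e * value b e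
    eval-mul a b e = let _ , _ , _ , _ , _ , p , _ = ev a b 0 e in p

    eval-apply : ∀ a b e → value (node applyᵒ a b) e ≡ f (value a e)
    eval-apply a b e = let _ , _ , _ , _ , _ , _ , _ , _ , _ , _ , p = ev a b 0 e in p

    eq-true : ∀ {a b e} → value a e ≡ value b e → True (eqᶜ a b) e
    eq-true {a} {b} {e} = let _ , _ , _ , _ , _ , _ , p , _ = ev a b 0 e in p

    eq-false : ∀ {a b e} → value a e ≢ value b e → value (eqᶜ a b) e ≡ 1
    eq-false {a} {b} {e} = let _ , _ , _ , _ , _ , _ , _ , p , _ = ev a b 0 e in p

    eq-sound : ∀ {a b e} → True (eqᶜ a b) e → value a e ≡ value b e
    eq-sound {a} {b} {e} t with value a e ≟ value b e
    ... | yes eq = eq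
    ... | no neq with trans (sym t) (eq-false neq)
    ...   | ()

    exists-true : ∀ {a e} → (Σ[ y ∈ ℕ ] True a (pair y e)) → True (existsᶜ a) e
    exists-true {a} {e} =
      let _ , _ , _ , _ , _ , _ , _ , _ , p , _ = ev a 0 0 e in p

    exists-sound : ∀ {a e} → True (existsᶜ a) e → Σ[ y ∈ ℕ ] True a (pair y e)
    exists-sound {a} {e} =
      let _ , _ , _ , _ , _ , _ , _ , _ , _ , p , _ = ev a 0 0 e in p

    eval-one : ∀ e → value (sucᶜ zeroᶜ) e ≡ 1
    eval-one e = trans (eval-suc zeroᶜ e) (cong suc (eval-zero e))

    neg-true : ∀ {a e} → ¬ True a e → True (negᶜ a) e
    neg-true {a} {e} ¬a = eq-true (trans
      (eq-false (λ eq → ¬a (trans eq (eval-zero e)))) (sym (eval-one e)))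

    neg-sound : ∀ {a e} → True (negᶜ a) e → ¬ True a e
    neg-sound {a} {e} t ta with trans (sym (eq-true (trans ta (sym (eval-zero e)))))
                                      (trans (eq-sound t) (eval-one e))
    ... | ()

    eval-pair : ∀ a b e → value (pairᶜ a b) e ≡ pair (value a e) (value b e)
    eval-pair a b e = begin
      value (pairᶜ a b) e                        ≡⟨ eval-add _ a e ⟩
      value (mulᶜ s s) e + x                     ≡⟨ cong (_+ x) (eval-mul s s e) ⟩
      value s e * value s e + x                  ≡⟨ cong (λ z → z * z + x) (eval-add a b e) ⟩
      (x + y) * (x + y) + x                      ≡⟨ pair-def x y ⟨
      pair x y                                   ∎
      where
      open ≡-Reasoning
      s = addᶜ a b
      x = value a e
      y = value b e

    eval-num : ∀ n e → value (numᶜ n) e ≡ n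
    eval-num zero    e = eval-zero e
    eval-num (suc n) e = trans (eval-suc _ e) (cong suc (eval-num n e))

    eval-var : ∀ {n} (i : Fin n) xs → value (varᶜ i) (env xs) ≡ Vec.lookup xs i
    eval-var zero    (x ∷ xs) = eval-top 0 0 x (env xs)
    eval-var (suc i) (x ∷ xs) = trans (eval-shift _ 0 x (env xs)) (eval-var i xs)

    module _ {k} {fs : Vec (ℕ → ℕ) k}
             (f-joins : ∀ i x → f (pair (toℕ i) x) ≡ Vec.lookup fs i x) where

      term-correct : ∀ {n} (t : Term k n) xs → value (termᶜ t) (env xs) ≡ ⟦ t ⟧ᵗ fs xs
      term-correct (var i)   xs = eval-var i xs
      term-correct (app i t) xs = begin
        value (termᶜ (app i t)) e                        ≡⟨ eval-apply _ 0 e ⟩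
        f (value (pairᶜ (numᶜ (toℕ i)) (termᶜ t)) e)     ≡⟨ cong f (eval-pair _ _ e) ⟩
        f (pair (value (numᶜ (toℕ i)) e) (value (termᶜ t) e))
          ≡⟨ cong₂ (λ m x → f (pair m x)) (eval-num (toℕ i) e) (term-correct t xs) ⟩
        f (pair (toℕ i) (⟦ t ⟧ᵗ fs xs))                  ≡⟨ f-joins i _ ⟩
        ⟦ app i t ⟧ᵗ fs xs                               ∎
        where
        open ≡-Reasoning
        e = env xs
      term-correct zeroᵗ     xs = eval-zero _
      term-correct (sucᵗ t)  xs = trans (eval-suc _ _) (cong suc (term-correct t xs))
      term-correct (s +ᵗ t)  xs =
        trans (eval-add _ _ _) (cong₂ _+_ (term-correct s xs) (term-correct t xs))
      term-correct (s *ᵗ t)  xs =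
        trans (eval-mul _ _ _) (cong₂ _*_ (term-correct s xs) (term-correct t xs))

      -- Mutual with completeness because of the premise of an implication. Case distinctions are
      -- made on whether a numerical truth value is 0, which is decidable.
      formula-sound : ∀ {n} (φ : Arithmetical k n) xs →
                      True (formulaᶜ φ) (env xs) → ⟦ φ ⟧ fs xs
      formula-complete : ∀ {n} (φ : Arithmetical k n) xs →
                         ⟦ φ ⟧ fs xs → True (formulaᶜ φ) (env xs)

      formula-sound (s ≈ᶠ t) xs p =
        trans (sym (term-correct s xs)) (trans (eq-sound p) (term-correct t xs))
      formula-sound ⊥ᶠ xs p with trans (sym p) (eval-one (env xs))
      ... | ()
      formula-sound (φ ∧ᶠ ψ) xs p =
          formula-sound φ xs (m+n≡0⇒m≡0 _ q)
        , formula-sound ψ xs (m+n≡0⇒n≡0 (value (formulaᶜ φ) (env xs)) q)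
        where
        q : value (formulaᶜ φ) (env xs) + value (formulaᶜ ψ) (env xs) ≡ 0
        q = trans (sym (eval-add _ _ _)) p
      formula-sound (φ ∨ᶠ ψ) xs p
        with m*n≡0⇒m≡0∨n≡0 (value (formulaᶜ φ) (env xs)) (trans (sym (eval-mul _ _ _)) p)
      ... | inj₁ q = inj₁ (formula-sound φ xs q)
      ... | inj₂ q = inj₂ (formula-sound ψ xs q)
      formula-sound (φ ⇒ᶠ ψ) xs p φ-holds
        with m*n≡0⇒m≡0∨n≡0 (value (negᶜ (formulaᶜ φ)) (env xs)) (trans (sym (eval-mul _ _ _)) p)
      ... | inj₁ q = ⊥-elim (neg-sound q (formula-complete φ xs φ-holds))
      ... | inj₂ q = formula-sound ψ xs q
      formula-sound (∀ᶠ φ) xs p x with value (formulaᶜ φ) (env (x ∷ xs)) ≟ 0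
      ... | yes q = formula-sound φ (x ∷ xs) q
      ... | no ¬q = ⊥-elim (neg-sound p (exists-true (x , neg-true ¬q)))
      formula-sound (∃ᶠ φ) xs p with exists-sound p
      ... | x , q = x , formula-sound φ (x ∷ xs) q

      formula-complete (s ≈ᶠ t) xs p =
        eq-true (trans (term-correct s xs) (trans p (sym (term-correct t xs))))
      formula-complete (φ ∧ᶠ ψ) xs (p , q) = trans (eval-add _ _ _)
        (cong₂ _+_ (formula-complete φ xs p) (formula-complete ψ xs q))
      formula-complete (φ ∨ᶠ ψ) xs (inj₁ p) = trans (eval-mul _ _ _)
        (cong (_* value (formulaᶜ ψ) (env xs)) (formula-complete φ xs p))
      formula-complete (φ ∨ᶠ ψ) xs (inj₂ q) = trans (eval-mul _ _ _)
        (trans (cong (value (formulaᶜ φ) (env xs) *_) (formula-complete ψ xs q))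
               (*-zeroʳ (value (formulaᶜ φ) (env xs))))
      formula-complete (φ ⇒ᶠ ψ) xs p with value (formulaᶜ φ) (env xs) ≟ 0
      ... | yes q = trans (eval-mul _ _ _)
        (trans (cong (value (negᶜ (formulaᶜ φ)) (env xs) *_)
                     (formula-complete ψ xs (p (formula-sound φ xs q))))
               (*-zeroʳ (value (negᶜ (formulaᶜ φ)) (env xs))))
      ... | no ¬q = trans (eval-mul _ _ _) (cong (_* value (formulaᶜ ψ) (env xs)) (neg-true ¬q))
      formula-complete (∀ᶠ φ) xs p = neg-true λ q →
        let x , ¬q = exists-sound q in
        neg-sound ¬q (formula-complete φ (x ∷ xs) (p x))
      formula-complete (∃ᶠ φ) xs (x , p) = exists-true (x , formula-complete φ (x ∷ xs) p)

-- Existence of evaluations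

data Tree : Set where
  leaf   : Tree
  branch : ℕ → Tree → Tree → Tree

module Evaluation (em : ExcludedMiddle 0ℓ) where

  IsPair : ℕ → Set
  IsPair n = Σ[ a ∈ ℕ ] Σ[ b ∈ ℕ ] pair a b ≡ n

  unpair : ∀ {n} → Dec (IsPair n) → ℕ × ℕ
  unpair (yes (a , b , _)) = a , b
  unpair (no _)            = 0 , 0

  unpair-pair : ∀ {a b} (d : Dec (IsPair (pair a b))) → unpair d ≡ (a , b)
  unpair-pair (yes (_ , _ , eq)) = let p , q = pair-injective eq in cong₂ _,_ p q
  unpair-pair (no ¬p)            = ⊥-elim (¬p (_ , _ , refl))

  π₁ π₂ : ℕ → ℕ
  π₁ n = proj₁ (unpair (em {IsPair n}))
  π₂ n = proj₂ (unpair (em {IsPair n}))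

  π₁-pair : ∀ a b → π₁ (pair a b) ≡ a
  π₁-pair a b = cong proj₁ (unpair-pair em)

  π₂-pair : ∀ a b → π₂ (pair a b) ≡ b
  π₂-pair a b = cong proj₂ (unpair-pair em)

  IsNode : ℕ → Set
  IsNode c = Σ[ j ∈ ℕ ] Σ[ a ∈ ℕ ] Σ[ b ∈ ℕ ] node j a b ≡ c

  -- Parts have smaller codes, so fuel `suc c` suffices for `c`, and by `parse-fuel` a surplus
  -- changes nothing.
  parse : (fuel c : ℕ) → Tree
  parse-node : (fuel : ℕ) → ∀ {c} → Dec (IsNode c) → Tree

  parse zero       c = leaf
  parse (suc fuel) c = parse-node fuel (em {IsNode c})

  parse-node fuel (yes (j , a , b , _)) = branch j (parse fuel a) (parse fuel b)
  parse-node fuel (no _)                = leaf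

  left<node : ∀ j a b → a < node j a b
  left<node j a b = ≤-<-trans (m≤pair a b) (n<pair-suc j (pair a b))

  right<node : ∀ j a b → b < node j a b
  right<node j a b = ≤-<-trans (n≤pair a b) (n<pair-suc j (pair a b))

  parse-fuel : ∀ {n m} c → c < n → c < m → parse n c ≡ parse m c
  parse-fuel {suc n} {suc m} c (s≤s c≤n) (s≤s c≤m) with em {IsNode c}
  ... | no _ = refl
  ... | yes (j , a , b , refl) = cong₂ (branch j)
    (parse-fuel a (<-≤-trans (left<node j a b) c≤n) (<-≤-trans (left<node j a b) c≤m))
    (parse-fuel b (<-≤-trans (right<node j a b) c≤n) (<-≤-trans (right<node j a b) c≤m))

  tree : ℕ → Tree
  tree c = parse (suc c) c

  tree-node : ∀ j a b → tree (node j a b) ≡ branch j (tree a) (tree b)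
  tree-node j a b with em {IsNode (node j a b)}
  ... | no ¬p = ⊥-elim (¬p (j , a , b , refl))
  ... | yes (j′ , a′ , b′ , eq) with pair-injective eq
  ...   | refl , eq′ with pair-injective eq′
  ...     | refl , refl = cong₂ (branch j)
    (parse-fuel a (left<node j a b) (n<1+n a))
    (parse-fuel b (right<node j a b) (n<1+n b))

  truth : ∀ {P : Set} → Dec P → ℕ
  truth (yes _) = 0
  truth (no _)  = 1

  truth-true : ∀ {P : Set} (d : Dec P) → P → truth d ≡ 0
  truth-true (yes _) p = refl
  truth-true (no ¬p) p = ⊥-elim (¬p p)

  truth-false : ∀ {P : Set} (d : Dec P) → ¬ P → truth d ≡ 1
  truth-false (yes p) ¬p = ⊥-elim (¬p p)
  truth-false (no _)  ¬p = refl

  truth-sound : ∀ {P : Set} (d : Dec P) → truth d ≡ 0 → P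
  truth-sound (yes p) _ = p

  eval : (ℕ → ℕ) → Tree → ℕ → ℕ
  eval f (branch topᵒ _ _)    e = π₁ e
  eval f (branch shiftᵒ a _)  e = eval f a (π₂ e)
  eval f (branch sucᵒ a _)    e = suc (eval f a e)
  eval f (branch addᵒ a b)    e = eval f a e + eval f b e
  eval f (branch mulᵒ a b)    e = eval f a e * eval f b e
  eval f (branch eqᵒ a b)     e = truth (eval f a e ≟ eval f b e)
  eval f (branch existsᵒ a _) e = truth (em {Σ[ y ∈ ℕ ] eval f a (pair y e) ≡ 0})
  eval f (branch applyᵒ a _)  e = f (eval f a e)
  -- This covers `zeroᵒ`, and by default leaves and unassigned tags.
  eval f _                    e = 0

  evaluation : (ℕ → ℕ) → ℕ → ℕ
  evaluation f n = eval f (tree (π₁ n)) (π₂ n)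

  module _ (f : ℕ → ℕ) where
    evaluation-pair : ∀ c e → evaluation f (pair c e) ≡ eval f (tree c) e
    evaluation-pair c e rewrite π₁-pair c e | π₂-pair c e = refl

    private
      T : ℕ → ℕ
      T = evaluation f

    evaluation-node : ∀ j a b e →
      T (pair (node j a b) e) ≡ eval f (branch j (tree a) (tree b)) e
    evaluation-node j a b e =
      trans (evaluation-pair _ e) (cong (λ t → eval f t e) (tree-node j a b))

    evaluation-correct : IsEvaluation f T
    evaluation-correct a b x e =
        trans (evaluation-node topᵒ a b _) (π₁-pair x e)
      , trans (evaluation-node shiftᵒ a b _)
              (trans (cong (eval f (tree a)) (π₂-pair x e)) (sym (at a e)))
      , evaluation-node zeroᵒ a b e
      , trans (evaluation-node sucᵒ a b e) (cong suc (sym (at a e)))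
      , trans (evaluation-node addᵒ a b e) (cong₂ _+_ (sym (at a e)) (sym (at b e)))
      , trans (evaluation-node mulᵒ a b e) (cong₂ _*_ (sym (at a e)) (sym (at b e)))
      , (λ p → trans (evaluation-node eqᵒ a b e)
                     (truth-true (_ ≟ _) (trans (sym (at a e)) (trans p (at b e)))))
      , (λ ¬p → trans (evaluation-node eqᵒ a b e)
                      (truth-false (_ ≟ _) λ p → ¬p (trans (at a e) (trans p (sym (at b e))))))
      , (λ (y , p) → trans (evaluation-node existsᵒ a b e)
                           (truth-true em (y , trans (sym (at a _)) p)))
      , (λ p → let y , q = truth-sound em (trans (sym (evaluation-node existsᵒ a b e)) p)
               in y , trans (at a _) q)
      , trans (evaluation-node applyᵒ a b e) (cong f (sym (at a e)))
      where
      at = evaluation-pair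

  nth : ∀ {k} → Vec (ℕ → ℕ) k → ℕ → ℕ → ℕ
  nth []       _       x = 0
  nth (f ∷ fs) zero    x = f x
  nth (f ∷ fs) (suc i) x = nth fs i x

  nth-lookup : ∀ {k} (fs : Vec (ℕ → ℕ) k) i x → nth fs (toℕ i) x ≡ Vec.lookup fs i x
  nth-lookup (f ∷ fs) zero    x = refl
  nth-lookup (f ∷ fs) (suc i) x = nth-lookup fs i x

  joined : ∀ {k} → Vec (ℕ → ℕ) k → ℕ → ℕ
  joined fs n = nth fs (π₁ n) (π₂ n)

  joined-pair : ∀ {k} (fs : Vec (ℕ → ℕ) k) i x →
                joined fs (pair (toℕ i) x) ≡ Vec.lookup fs i x
  joined-pair fs i x rewrite π₁-pair (toℕ i) x | π₂-pair (toℕ i) x = nth-lookup fs i x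

  -- From left to right, the functions `fs` are joined into one, whose evaluation exists. From right
  -- to left, an arbitrary `f` is cut into its first k sections; correctness of the coding holds for
  -- every evaluation of `f`.
  universality : ∀ {k} (θ : Arithmetical k 2) a b →
    Universal (Encoding.formulaᶜ θ) a b ⇔ (∀ fs → ⟦ θ ⟧ fs (a ∷ b ∷ []))
  universality {k} θ a b = mk⇔ sound complete
    where
    open Encoding.Correct

    sound : Universal (Encoding.formulaᶜ θ) a b → ∀ fs → ⟦ θ ⟧ fs (a ∷ b ∷ [])
    sound u fs = formula-sound {f} {evaluation f} ev (joined-pair fs) θ (a ∷ b ∷ []) (u f (evaluation f) ev)
      where
      f  = joined fs
      ev = evaluation-correct f

    complete : (∀ fs → ⟦ θ ⟧ fs (a ∷ b ∷ [])) → Universal (Encoding.formulaᶜ θ) a b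
    complete h f T ev = formula-complete {f} {T} ev {k} {fs}
      (λ i x → cong (λ g → g x) (sym (lookup∘tabulate part i))) θ (a ∷ b ∷ []) (h fs)
      where
      part : Fin k → ℕ → ℕ
      part i x = f (pair (toℕ i) x)
      fs = Vec.tabulate part

-- Strings and their codes

length-∷ʳ : ∀ τ (b : Bool) → length (τ ∷ʳ b) ≡ suc (length τ)
length-∷ʳ τ b = trans (length-++ τ) (+-comm (length τ) 1)

code-∷ʳ : ∀ τ b → code (τ ∷ʳ b) ≡ 2 * code τ + val b
code-∷ʳ τ b = foldl-∷ʳ _ 0 b τ

bit-last : ∀ τ b → bit (τ ∷ʳ b) (length τ) ≡ val b
bit-last []      b = refl
bit-last (_ ∷ τ) b = bit-last τ b

bit-init : ∀ τ b {n} → n ≢ length τ → bit (τ ∷ʳ b) n ≡ bit τ n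
bit-init []      b {zero}  n≢ = ⊥-elim (n≢ refl)
bit-init []      b {suc n} n≢ = refl
bit-init (_ ∷ τ) b {zero}  n≢ = refl
bit-init (_ ∷ τ) b {suc n} n≢ = bit-init τ b (n≢ ∘ cong suc)

bit-beyond : ∀ τ {n} → length τ ≤ n → bit τ n ≡ 0
bit-beyond []      _         = refl
bit-beyond (_ ∷ τ) (s≤s l≤n) = bit-beyond τ l≤n

bit-within : ∀ τ {n} → n < length τ → bit τ n ≢ 0
bit-within (false ∷ τ) {zero}  _         ()
bit-within (true ∷ τ)  {zero}  _         ()
bit-within (_ ∷ τ)     {suc n} (s≤s n<l) = bit-within τ n<l

bit≢0⇒within : ∀ τ {n} → bit τ n ≢ 0 → n < length τ
bit≢0⇒within τ {n} ≢0 with <-≤-connex n (length τ)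
... | inj₁ n<l = n<l
... | inj₂ l≤n = ⊥-elim (≢0 (bit-beyond τ l≤n))

-- `code` is bijective base 2 with digits 1 and 2. Adding 1 turns a last digit 1 into 2, and a last
-- digit 2 into 1 with a carry.
increment : ∀ {τ} → Reverse τ → Σ[ τ′ ∈ 2^<ω ] code τ′ ≡ suc (code τ)
increment []                = false ∷ [] , refl
increment (τ ∶ _ ∶ʳ false) = τ ∷ʳ true , (begin
  code (τ ∷ʳ true)          ≡⟨ code-∷ʳ τ true ⟩
  2 * code τ + 2            ≡⟨ +-suc (2 * code τ) 1 ⟩
  suc (2 * code τ + 1)      ≡⟨ cong suc (code-∷ʳ τ false) ⟨
  suc (code (τ ∷ʳ false))   ∎)
  where open ≡-Reasoning
increment (τ ∶ r ∶ʳ true) with increment r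
... | τ′ , eq = τ′ ∷ʳ false , (begin
  code (τ′ ∷ʳ false)        ≡⟨ code-∷ʳ τ′ false ⟩
  2 * code τ′ + 1           ≡⟨ cong (λ c → 2 * c + 1) eq ⟩
  2 * suc (code τ) + 1      ≡⟨ cong (_+ 1) (*-suc 2 (code τ)) ⟩
  2 + 2 * code τ + 1        ≡⟨ +-comm (2 + 2 * code τ) 1 ⟩
  suc (2 + 2 * code τ)      ≡⟨ cong suc (+-comm 2 (2 * code τ)) ⟩
  suc (2 * code τ + 2)      ≡⟨ cong suc (code-∷ʳ τ true) ⟨
  suc (code (τ ∷ʳ true))    ∎)
  where open ≡-Reasoning

code-surjective : ∀ c → Σ[ τ ∈ 2^<ω ] code τ ≡ c
code-surjective zero    = [] , refl
code-surjective (suc c) with code-surjective c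
... | τ , refl = increment (reverseView τ)

val≢0 : ∀ b → val b ≢ 0
val≢0 false ()
val≢0 true  ()

0≢2*+val : ∀ c b → 0 ≢ 2 * c + val b
0≢2*+val c b eq = val≢0 b (m+n≡0⇒n≡0 (2 * c) (sym eq))

2*+val-injective : ∀ c d b b′ → 2 * c + val b ≡ 2 * d + val b′ → c ≡ d × b ≡ b′
2*+val-injective c d false false eq =
  *-cancelˡ-≡ c d 2 (+-cancelʳ-≡ 1 (2 * c) (2 * d) eq) , refl
2*+val-injective c d true true eq =
  *-cancelˡ-≡ c d 2 (+-cancelʳ-≡ 2 (2 * c) (2 * d) eq) , refl
2*+val-injective c d false true eq = ⊥-elim (even≢odd c d (suc-injective (begin
  suc (2 * c)      ≡⟨ +-comm 1 (2 * c) ⟩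
  2 * c + 1        ≡⟨ eq ⟩
  2 * d + 2        ≡⟨ +-comm (2 * d) 2 ⟩
  suc (suc (2 * d)) ∎)))
  where open ≡-Reasoning
2*+val-injective c d true false eq = ⊥-elim (even≢odd d c (suc-injective (begin
  suc (2 * d)      ≡⟨ +-comm 1 (2 * d) ⟩
  2 * d + 1        ≡⟨ eq ⟨
  2 * c + 2        ≡⟨ +-comm (2 * c) 2 ⟩
  suc (suc (2 * c)) ∎)))
  where open ≡-Reasoning

code-injective : ∀ {σ τ} → code σ ≡ code τ → σ ≡ τ
code-injective {σ} {τ} = go (reverseView σ) (reverseView τ)
  where
  go : ∀ {σ τ} → Reverse σ → Reverse τ → code σ ≡ code τ → σ ≡ τ
  go []             []             eq = refl
  go []             (τ ∶ _ ∶ʳ b)   eq = ⊥-elim (0≢2*+val (code τ) b (trans eq (code-∷ʳ τ b)))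
  go (σ ∶ _ ∶ʳ b)   []             eq = ⊥-elim (0≢2*+val (code σ) b (trans (sym eq) (code-∷ʳ σ b)))
  go (σ ∶ rσ ∶ʳ b) (τ ∶ rτ ∶ʳ b′) eq =
    let p , q = 2*+val-injective (code σ) (code τ) b b′
                  (trans (sym (code-∷ʳ σ b)) (trans eq (code-∷ʳ τ b′)))
    in cong₂ _∷ʳ_ (go rσ rτ p) q

str : ℕ → 2^<ω
str c = proj₁ (code-surjective c)

code-str : ∀ c → code (str c) ≡ c
code-str c = proj₂ (code-surjective c)

str-code : ∀ τ → str (code τ) ≡ τ
str-code τ = code-injective (code-str (code τ))

str-snoc : ∀ c b → str (2 * c + val b) ≡ str c ∷ʳ b
str-snoc c b = code-injective (begin
  code (str (2 * c + val b))  ≡⟨ code-str _ ⟩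
  2 * c + val b               ≡⟨ cong (λ d → 2 * d + val b) (code-str c) ⟨
  2 * code (str c) + val b    ≡⟨ code-∷ʳ (str c) b ⟨
  code (str c ∷ʳ b)           ∎)
  where open ≡-Reasoning

-- Extensions that respect columns

Pre-refl : ∀ {t} → Pre t t
Pre-refl n _ = refl

Pre-trans : ∀ {t t₁ t₂} → Pre t t₁ → Pre t₁ t₂ → Pre t t₂
Pre-trans p q n ≢0 = trans (q n (≢0 ∘ trans (sym (p n ≢0)))) (p n ≢0)

Pre-resp : ∀ {t t′ u u′} → t ≗ t′ → u ≗ u′ → Pre t u → Pre t′ u′
Pre-resp t≗ u≗ p n ≢0 =
  trans (sym (u≗ n)) (trans (p n (≢0 ∘ trans (sym (t≗ n)))) (t≗ n))

Ext-refl : ∀ {s t} → Ext s t t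
Ext-refl = Pre-refl , λ i m _ t≡0 t≡2 → 0≢1+n (trans (sym t≡0) t≡2)

Ext-trans : ∀ {s t t₁ t₂} → Ext s t t₁ → Ext s t₁ t₂ → Ext s t t₂
Ext-trans {t₁ = t₁} (p , a) (q , b) = Pre-trans p q , λ i m s≡2 t≡0 t₂≡2 →
  avoid i m s≡2 t≡0 t₂≡2 (t₁ (pair i m) ≟ 0)
  where
  avoid : ∀ i m → _ → _ → _ → Dec (t₁ (pair i m) ≡ 0) → ⊥
  avoid i m s≡2 t≡0 t₂≡2 (yes t₁≡0) = b i m s≡2 t₁≡0 t₂≡2
  avoid i m s≡2 t≡0 t₂≡2 (no t₁≢0)  = a i m s≡2 t≡0 (trans (sym (q _ t₁≢0)) t₂≡2)

Ext-weaken : ∀ {s s′ t t′} → (∀ i → s i ≡ 2 → s′ i ≡ 2) → Ext s′ t t′ → Ext s t t′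
Ext-weaken s⊆s′ (p , a) = p , λ i m s≡2 → a i m (s⊆s′ i s≡2)

Ext-resp : ∀ {s s′ t t′ u u′} → s ≗ s′ → t ≗ t′ → u ≗ u′ → Ext s t u → Ext s′ t′ u′
Ext-resp s≗ t≗ u≗ (p , a) = Pre-resp t≗ u≗ p , λ i m s≡2 t≡0 u≡2 →
  a i m (trans (s≗ i) s≡2) (trans (t≗ _) t≡0) (trans (u≗ _) u≡2)

Pre-∷ʳ : ∀ τ b → Pre (bit τ) (bit (τ ∷ʳ b))
Pre-∷ʳ τ b n ≢0 = bit-init τ b (<⇒≢ (bit≢0⇒within τ ≢0))

-- Definability of Reach

module Coding {L H : ℕ → ℕ} (coding : IsStringCoding L H) where

  private
    L-nil  = proj₁ coding
    H-nil  = proj₁ (proj₂ coding)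
    snoc   = proj₂ (proj₂ coding)

    snoc-spec : ∀ c b → L (2 * c + val b) ≡ suc (L c) ×
                        H (pair (2 * c + val b) (L c)) ≡ val b ×
                        (∀ i → i ≢ L c → H (pair (2 * c + val b) i) ≡ H (pair c i))
    snoc-spec c false = let p , _ , q , _ , r = snoc c in p , q , λ i i≢ → proj₁ (r i i≢)
    snoc-spec c true  = let _ , p , _ , q , r = snoc c in p , q , λ i i≢ → proj₂ (r i i≢)

  coding-length : ∀ τ → L (code τ) ≡ length τ
  coding-length τ = go (reverseView τ)
    where
    go : ∀ {τ} → Reverse τ → L (code τ) ≡ length τ
    go []            = L-nil
    go (τ ∶ r ∶ʳ b) = begin
      L (code (τ ∷ʳ b))         ≡⟨ cong L (code-∷ʳ τ b) ⟩
      L (2 * code τ + val b)    ≡⟨ proj₁ (snoc-spec (code τ) b) ⟩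
      suc (L (code τ))          ≡⟨ cong suc (go r) ⟩
      suc (length τ)            ≡⟨ length-∷ʳ τ b ⟨
      length (τ ∷ʳ b)           ∎
      where open ≡-Reasoning

  coding-bit : ∀ τ → section H (code τ) ≗ bit τ
  coding-bit τ = go (reverseView τ)
    where
    go : ∀ {τ} → Reverse τ → section H (code τ) ≗ bit τ
    go []            i = H-nil i
    go (τ ∶ r ∶ʳ b) i rewrite code-∷ʳ τ b with i ≟ length τ
    ... | yes refl = begin
      H (pair (2 * code τ + val b) (length τ))
        ≡⟨ cong (λ l → H (pair (2 * code τ + val b) l)) (coding-length τ) ⟨
      H (pair (2 * code τ + val b) (L (code τ)))
        ≡⟨ proj₁ (proj₂ (snoc-spec (code τ) b)) ⟩
      val b
        ≡⟨ bit-last τ b ⟨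
      bit (τ ∷ʳ b) (length τ)  ∎
      where open ≡-Reasoning
    ... | no i≢ = begin
      H (pair (2 * code τ + val b) i)
        ≡⟨ proj₂ (proj₂ (snoc-spec (code τ) b)) i (λ eq → i≢ (trans eq (coding-length τ))) ⟩
      H (pair (code τ) i)  ≡⟨ go r i ⟩
      bit τ i              ≡⟨ bit-init τ b i≢ ⟨
      bit (τ ∷ʳ b) i       ∎
      where open ≡-Reasoning

  coding-bit-true : ∀ σ → section H (2 * code σ + 2) ≗ bit (σ ∷ʳ true)
  coding-bit-true σ i =
    trans (cong (λ c → H (pair c i)) (sym (code-∷ʳ σ true))) (coding-bit (σ ∷ʳ true) i)

  -- Once `υ` and `ρ` are found, the section of (F , T) at their index is just one instance of the
  -- quantifier in `Universal`. Hence this direction needs no special choice of F and T.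
  forces⇒code : ∀ {F T} → (∀ p → IsEvaluation (section F p) (section T p)) →
                ∀ {τ σ} → Forces τ σ → ForcesCode T L H (code τ) (code σ)
  forces⇒code {F} {T} ev {τ} {σ} forces t₁ ext with code-surjective t₁
  ... | τ₁ , refl with forces τ₁ (Ext-resp (coding-bit-true σ) (coding-bit τ) (coding-bit τ₁) ext)
  ...   | τ₂ , υ , ρ , ext₂ , pre , ρ-bit , univ =
      code τ₂ , code υ , code ρ
    , Ext-resp (sym ∘ coding-bit σ) (sym ∘ coding-bit τ₁) (sym ∘ coding-bit τ₂) ext₂
    , Pre-resp (sym ∘ coding-bit υ) (sym ∘ coding-bit τ₂) pre
    , trans (coding-bit ρ _) (trans (cong (bit ρ) (coding-length σ)) ρ-bit)
    , subst (λ k → T (pair (pair k _) (pair k _)) ≡ 0) (sym (coding-length σ))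
        (univ (section F p) (section T p) (ev p))
    where
    p = pair (length σ) (pair (code υ) (code ρ))

reach⇒code : ∀ F T R L H {τ σ} → Reach τ σ → ReachCode F T R L H (code τ) (code σ)
reach⇒code F T R L H reach ev coding r-start r-stay r-exit = go reach
  where
  open Coding {L} {H} coding

  go : ∀ {τ σ} → Reach τ σ → R (pair (code τ) (code σ)) ≡ 0
  go start = r-start
  go (stay {τ} {σ} r forces) =
    subst (λ s → R (pair (code τ) s) ≡ 0) (sym (code-∷ʳ σ true))
      (r-stay _ _ (go r) (forces⇒code {F} {T} ev {τ} {σ} forces))
  go (exit {τ} {σ} τ′ m r ext len) =
    subst₂ (λ t s → R (pair t s) ≡ 0) (sym (code-∷ʳ τ′ true)) (sym (code-∷ʳ σ false))
      (r-exit _ _ _ m (go r)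
        (Ext-resp (sym ∘ coding-bit-true σ) (sym ∘ coding-bit τ) (sym ∘ coding-bit τ′) ext)
        (trans (coding-length τ′)
          (trans len (cong (λ l → pair l m) (sym (coding-length σ))))))

-- For sections of F and T, which agree with the chosen functions only pointwise.
IsEvaluation-resp : ∀ {f f′ T T′} → f ≗ f′ → T ≗ T′ → IsEvaluation f T → IsEvaluation f′ T′
IsEvaluation-resp {f} {f′} {T} {T′} f≗ T≗ ev a b x e =
  let top , shift , zro , sc , add , mul , eq₀ , eq₁ , ex₀ , ex , apply = ev a b x e in
    move top
  , trans (move shift) (T≗ _)
  , move zro
  , trans (move sc) (cong suc (T≗ _))
  , trans (move add) (cong₂ _+_ (T≗ _) (T≗ _))
  , trans (move mul) (cong₂ _*_ (T≗ _) (T≗ _))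
  , (λ p → move (eq₀ (trans (T≗ _) (trans p (sym (T≗ _))))))
  , (λ ¬p → move (eq₁ λ p → ¬p (move (trans p (T≗ _)))))
  , (λ (y , p) → move (ex₀ (y , trans (T≗ _) p)))
  , (λ p → let y , q = ex (trans (T≗ _) p) in y , move q)
  , trans (move apply) (trans (f≗ _) (cong f′ (T≗ _)))
  where
  move : ∀ {n m} → T n ≡ m → T′ n ≡ m
  move p = trans (sym (T≗ _)) p

module Definability (em : ExcludedMiddle 0ℓ) where
  open Evaluation em

  -- The choice that justifies moving the quantifier over (f , T) outwards.
  Refuter : ℕ → ℕ → ℕ → Set
  Refuter k a b = Σ[ f ∈ (ℕ → ℕ) ] Σ[ T ∈ (ℕ → ℕ) ]
    (IsEvaluation f T × (T (pair k (pair a (pair b 0))) ≡ 0 → Universal k a b))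

  refuter : ∀ k a b → Refuter k a b
  refuter k a b with em {Σ[ f ∈ (ℕ → ℕ) ] Σ[ T ∈ (ℕ → ℕ) ]
                         (IsEvaluation f T × T (pair k (pair a (pair b 0))) ≢ 0)}
  ... | yes (f , T , ev , ≢0) = f , T , ev , ⊥-elim ∘ ≢0
  -- With no refutation `Universal` holds outright, so any evaluation will do; that of the zero
  -- function is taken.
  ... | no ¬refutation = (λ _ → 0) , evaluation (λ _ → 0) , evaluation-correct (λ _ → 0) ,
    λ _ f T ev → decidable-stable (_ ≟ 0) λ ≢0 → ¬refutation (f , T , ev , ≢0)

  refuterAt : ∀ p → Refuter (π₁ p) (π₁ (π₂ p)) (π₂ (π₂ p))
  refuterAt p = refuter (π₁ p) (π₁ (π₂ p)) (π₂ (π₂ p))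

  -- The one instance from which `ReachCode` gives back `Reach`: R is `Reach` itself, L and H are
  -- the true lengths and bits, and the sections of F and T refute `Universal` wherever it fails.
  F T R L H : ℕ → ℕ
  F n = proj₁ (refuterAt (π₁ n)) (π₂ n)
  T n = proj₁ (proj₂ (refuterAt (π₁ n))) (π₂ n)
  R n = truth (em {Reach (str (π₁ n)) (str (π₂ n))})
  L c = length (str c)
  H n = bit (str (π₁ n)) (π₂ n)

  uncurried : ∀ {ℓ} {A : Set ℓ} (g : ℕ → ℕ → A) m n → g m n ≡ g (π₁ (pair m n)) (π₂ (pair m n))
  uncurried g m n = cong₂ g (sym (π₁-pair m n)) (sym (π₂-pair m n))

  evaluations : ∀ p → IsEvaluation (section F p) (section T p)
  evaluations p = IsEvaluation-resp
    (uncurried (λ p → proj₁ (refuterAt p)) p)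
    (uncurried (λ p → proj₁ (proj₂ (refuterAt p))) p)
    (proj₁ (proj₂ (proj₂ (refuterAt p))))

  universal-at : ∀ k a b → T (pair (pair k (pair a b)) (pair k (pair a (pair b 0)))) ≡ 0 →
                 Universal k a b
  universal-at k a b eq = subst (λ (k , a , b) → Universal k a b) parts
    (proj₂ (proj₂ (proj₂ (refuterAt p)))
      (trans (cong (λ (k , a , b) → proj₁ (proj₂ (refuterAt p)) (pair k (pair a (pair b 0)))) parts)
        (trans (uncurried (λ p → proj₁ (proj₂ (refuterAt p))) p (pair k (pair a (pair b 0)))) eq)))
    where
    p = pair k (pair a b)
    rest : π₂ p ≡ pair a b
    rest = π₂-pair k (pair a b)
    parts : (π₁ p , π₁ (π₂ p) , π₂ (π₂ p)) ≡ (k , a , b)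
    parts = cong₂ _,_ (π₁-pair k (pair a b))
      (cong₂ _,_ (trans (cong π₁ rest) (π₁-pair a b)) (trans (cong π₂ rest) (π₂-pair a b)))

  H-bit : ∀ c → section H c ≗ bit (str c)
  H-bit c i = sym (uncurried (λ c → bit (str c)) c i)

  coding : IsStringCoding L H
  coding = refl , H-bit 0 , λ c →
      length-snoc c false , length-snoc c true , last c false , last c true
    , λ i i≢ → init c false i≢ , init c true i≢
    where
    length-snoc : ∀ c b → L (2 * c + val b) ≡ suc (L c)
    length-snoc c b = trans (cong length (str-snoc c b)) (length-∷ʳ (str c) b)

    snoc-bit : ∀ c b i → H (pair (2 * c + val b) i) ≡ bit (str c ∷ʳ b) i
    snoc-bit c b i = trans (H-bit _ i) (cong (λ τ → bit τ i) (str-snoc c b))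

    last : ∀ c b → H (pair (2 * c + val b) (L c)) ≡ val b
    last c b = trans (snoc-bit c b (L c)) (bit-last (str c) b)

    init : ∀ c b {i} → i ≢ L c → H (pair (2 * c + val b) i) ≡ H (pair c i)
    init c b {i} i≢ = trans (snoc-bit c b i) (trans (bit-init (str c) b i≢) (sym (H-bit c i)))

  R-true : ∀ {t s} → Reach (str t) (str s) → R (pair t s) ≡ 0
  R-true {t} {s} r = truth-true em
    (subst id (uncurried (λ t s → Reach (str t) (str s)) t s) r)

  R-sound : ∀ {t s} → R (pair t s) ≡ 0 → Reach (str t) (str s)
  R-sound {t} {s} eq =
    subst id (sym (uncurried (λ t s → Reach (str t) (str s)) t s)) (truth-sound em eq)

  H-bit-true : ∀ s → section H (2 * s + 2) ≗ bit (str s ∷ʳ true)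
  H-bit-true s i = trans (H-bit _ i) (cong (λ σ → bit σ i) (str-snoc s true))

  code⇒forces : ∀ {t s} → ForcesCode T L H t s → Forces (str t) (str s)
  code⇒forces {t} {s} forces τ₁ ext
    with forces (code τ₁) (Ext-resp (sym ∘ H-bit-true s) (sym ∘ H-bit t) bit-τ₁ ext)
    where
    bit-τ₁ : bit τ₁ ≗ section H (code τ₁)
    bit-τ₁ i = sym (trans (H-bit _ i) (cong (λ τ → bit τ i) (str-code τ₁)))
  ... | t₂ , u , r , ext₂ , pre , r-bit , eq =
      str t₂ , str u , str r
    , Ext-resp (H-bit s) (λ i → trans (H-bit _ i) (cong (λ τ → bit τ i) (str-code τ₁)))
               (H-bit t₂) ext₂
    , Pre-resp (H-bit u) (H-bit t₂) pre
    , trans (sym (H-bit r _)) r-bit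
    , subst₂ (Universal _) (sym (code-str u)) (sym (code-str r)) (universal-at _ u r eq)

  code⇒reach : ∀ {τ σ} → ReachCode F T R L H (code τ) (code σ) → Reach τ σ
  code⇒reach {τ} {σ} h = subst₂ Reach (str-code τ) (str-code σ) (R-sound
    (h evaluations coding (R-true start) r-stay r-exit))
    where
    r-stay : ∀ t s → R (pair t s) ≡ 0 → ForcesCode T L H t s → R (pair t (2 * s + 2)) ≡ 0
    r-stay t s r forces = R-true (subst (Reach (str t)) (sym (str-snoc s true))
      (stay (R-sound r) (code⇒forces forces)))

    r-exit : ∀ t s t′ m → R (pair t s) ≡ 0 →
      Ext (section H (2 * s + 2)) (section H t) (section H t′) →
      L t′ ≡ pair (L s) m → R (pair (2 * t′ + 2) (2 * s + 1)) ≡ 0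
    r-exit t s t′ m r ext len = R-true
      (subst₂ Reach (sym (str-snoc t′ true)) (sym (str-snoc s false))
        (exit (str t′) m (R-sound r) (Ext-resp (H-bit-true s) (H-bit t) (H-bit t′) ext) len))

  reachIsΠ¹₁ : IsΠ¹₁ Reach
  reachIsΠ¹₁ = 5 , Formula.reachᶠ , λ τ σ → mk⇔ (sound τ σ) (complete τ σ)
    where
    sound : ∀ τ σ → Reach τ σ → ∀ fs → ⟦ Formula.reachᶠ ⟧ fs (code τ ∷ code σ ∷ [])
    sound τ σ r (F ∷ T ∷ R ∷ L ∷ H ∷ []) =
      subst id (sym (Formula.reachᶠ-semantics F T R L H (code τ) (code σ)))
        (reach⇒code F T R L H r)

    complete : ∀ τ σ → (∀ fs → ⟦ Formula.reachᶠ ⟧ fs (code τ ∷ code σ ∷ [])) → Reach τ σ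
    complete τ σ h =
      code⇒reach (subst id (Formula.reachᶠ-semantics F T R L H (code τ) (code σ))
        (h (F ∷ T ∷ R ∷ L ∷ H ∷ [])))

  functional : HigherTuringFunctional
  functional = record { Graph = Reach ; isΠ¹₁ = reachIsΠ¹₁ }

-- Strings as finite parts of oracles

val-injective : ∀ {b b′} → val b ≡ val b′ → b ≡ b′
val-injective {false} {false} _ = refl
val-injective {true}  {true}  _ = refl

bit-true-or-false : ∀ τ n → bit τ n ≢ 0 → bit τ n ≡ 1 ⊎ bit τ n ≡ 2
bit-true-or-false []          n       ≢0 = ⊥-elim (≢0 refl)
bit-true-or-false (false ∷ _) zero    _  = inj₁ refl
bit-true-or-false (true ∷ _)  zero    _  = inj₂ refl
bit-true-or-false (_ ∷ τ)     (suc n) ≢0 = bit-true-or-false τ n ≢0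

at⇒bit : ∀ σ {n b} → σ at n is b → bit σ n ≡ val b
at⇒bit (_ ∷ _) (zero  , refl , refl) = refl
at⇒bit (_ ∷ σ) (suc i , refl , eq)   = at⇒bit σ (i , refl , eq)

bit⇒at : ∀ σ n {b} → bit σ n ≡ val b → σ at n is b
bit⇒at []      n       {false} ()
bit⇒at []      n       {true}  ()
bit⇒at (_ ∷ σ) zero    eq = zero , refl , val-injective eq
bit⇒at (_ ∷ σ) (suc n) eq = let i , p , q = bit⇒at σ n eq in suc i , cong suc p , q

bit-↾ : ∀ A {n m} → n < m → bit (applyUpTo A m) n ≡ bits A n
bit-↾ A {zero}  (s≤s _)   = refl
bit-↾ A {suc n} (s≤s n<m) = bit-↾ (A ∘ suc) n<m

Pre-↾ : ∀ A n → Pre (bit (applyUpTo A n)) (bits A)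
Pre-↾ A n i ≢0 = sym (bit-↾ A (subst (i <_) (length-applyUpTo A n) (bit≢0⇒within (applyUpTo A n) ≢0)))

≺⇒Pre : ∀ {τ A} → τ ≺ A → Pre (bit τ) (bits A)
≺⇒Pre {τ} {A} τ≺A = subst (λ υ → Pre (bit υ) (bits A)) (sym τ≺A) (Pre-↾ A (length τ))

Pre⇒≺ : ∀ τ {A} → Pre (bit τ) (bits A) → τ ≺ A
Pre⇒≺ []      _ = refl
Pre⇒≺ (b ∷ τ) p = cong₂ _∷_
  (sym (val-injective (p 0 (bit-within (b ∷ τ) (s≤s z≤n)))))
  (Pre⇒≺ τ (p ∘ suc))

Pre-applyUpTo : ∀ {t A n} → (∀ i → t i ≢ 0 → i < n) → Pre t (bits A) → Pre t (bit (applyUpTo A n))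
Pre-applyUpTo {A = A} within p i ≢0 = trans (bit-↾ A (within i ≢0)) (p i ≢0)

-- `Forces` and `Answered` speak of strings, so A has to be cut off. Positions beyond the cut have
-- value 0 and add no new 1.
Ext-applyUpTo : ∀ {s} τ {A n} → length τ ≤ n → Ext s (bit τ) (bits A) →
                Ext s (bit τ) (bit (applyUpTo A n))
Ext-applyUpTo τ {A} {n} l≤n (p , a) =
    Pre-applyUpTo (λ i ≢0 → <-≤-trans (bit≢0⇒within τ ≢0) l≤n) p
  , λ i m s≡2 t≡0 eq → a i m s≡2 t≡0
      (trans (Pre-↾ A n _ λ eq₀ → 0≢1+n (trans (sym eq₀) eq)) eq)

Pre⇒length≤ : ∀ τ υ → Pre (bit τ) (bit υ) → length τ ≤ length υ
Pre⇒length≤ τ υ p = ≮⇒≥ λ υ<τ →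
  bit-within τ υ<τ (trans (sym (p _ (bit-within τ υ<τ))) (bit-beyond υ ≤-refl))

Prefix⇒Pre : ∀ {σ σ′} → Prefix _≡_ σ σ′ → Pre (bit σ) (bit σ′)
Prefix⇒Pre []           n       ≢0 = ⊥-elim (≢0 refl)
Prefix⇒Pre (refl ∷ p)   zero    ≢0 = refl
Prefix⇒Pre (refl ∷ p)   (suc n) ≢0 = Prefix⇒Pre p n ≢0

Comparable⇒bits-agree : ∀ σ σ′ {n b b′} → Comparable σ σ′ →
                        bit σ n ≡ val b → bit σ′ n ≡ val b′ → b ≡ b′
Comparable⇒bits-agree σ σ′ {n} {b} {b′} c p q = val-injective (go c)
  where
  go : Comparable σ σ′ → val b ≡ val b′
  go (inj₁ σ⊑) = trans (sym p) (trans (sym (Prefix⇒Pre σ⊑ n (val≢0 b ∘ trans (sym p)))) q)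
  go (inj₂ σ⊒) = trans (sym p) (trans (Prefix⇒Pre σ⊒ n (val≢0 b′ ∘ trans (sym q))) q)

applyUpTo-comparable : ∀ X m n → Comparable (applyUpTo X m) (applyUpTo X n)
applyUpTo-comparable X zero    n       = inj₁ []
applyUpTo-comparable X (suc m) zero    = inj₂ []
applyUpTo-comparable X (suc m) (suc n) with applyUpTo-comparable (X ∘ suc) m n
... | inj₁ p = inj₁ (refl ∷ p)
... | inj₂ p = inj₂ (refl ∷ p)

Ext-∷ʳ : ∀ {s} τ b → (b ≡ true → ∀ i m → length τ ≡ pair i m → s i ≢ 2) →
         Ext s (bit τ) (bit (τ ∷ʳ b))
Ext-∷ʳ {s} τ b allowed = Pre-∷ʳ τ b , λ i m s≡2 t≡0 eq → go i m s≡2 t≡0 eq (pair i m ≟ length τ)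
  where
  go : ∀ i m → s i ≡ 2 → bit τ (pair i m) ≡ 0 → bit (τ ∷ʳ b) (pair i m) ≡ 2 →
       Dec (pair i m ≡ length τ) → ⊥
  go i m s≡2 t≡0 eq (yes p) = allowed
    (val-injective (trans (sym (bit-last τ b)) (trans (cong (bit (τ ∷ʳ b)) (sym p)) eq)))
    i m (sym p) s≡2
  go i m s≡2 t≡0 eq (no ¬p) with trans (sym t≡0) (trans (sym (bit-init τ b ¬p)) eq)
  ... | ()

-- Appended bits `false` violate no column. Padding is used to end a string just before a position
-- of the desired column.
pad : ∀ {s} τ d → Σ[ τ′ ∈ 2^<ω ] (Ext s (bit τ) (bit τ′) × length τ′ ≡ d + length τ)
pad τ zero    = τ , Ext-refl , refl
pad τ (suc d) with pad τ d
... | τ′ , ext , len =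
  τ′ ∷ʳ false , Ext-trans ext (Ext-∷ʳ τ′ false λ ()) , trans (length-∷ʳ τ′ false) (cong suc len)

⊆-∷ʳ : ∀ σ b i → bit σ i ≡ 2 → bit (σ ∷ʳ b) i ≡ 2
⊆-∷ʳ σ b i eq = trans (Pre-∷ʳ σ b i (λ eq₀ → 0≢1+n (trans (sym eq₀) eq))) eq

-- The construction of A and X

-- The last index is the next bit of X. In the case left, A leaves the set of points
-- whose column length σ is empty beyond τ.

data Step (τ σ : 2^<ω) : 2^<ω → 2^<ω → Bool → Set where
  forced : Forces τ σ → Step τ σ τ (σ ∷ʳ true) true
  left   : ∀ τ′ m → Ext (bit (σ ∷ʳ true)) (bit τ) (bit τ′) →
           length τ′ ≡ pair (length σ) m → ¬ Answered σ τ′ →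
           Step τ σ (τ′ ∷ʳ true) (σ ∷ʳ false) false

-- The new 1 lies in column `length σ`, which is beyond the end of `σ` and so unrestricted.
Ext-∷ʳ-true : ∀ {m} σ τ → length τ ≡ pair (length σ) m → Ext (bit σ) (bit τ) (bit (τ ∷ʳ true))
Ext-∷ʳ-true σ τ len = Ext-∷ʳ τ true λ _ i m eq s≡2 → 0≢1+n
  (trans (sym (bit-beyond σ (≤-reflexive (proj₁ (pair-injective (trans (sym len) eq)))))) s≡2)

module _ {τ σ τ″ σ″ : 2^<ω} {b : Bool} where
  step-side : Step τ σ τ″ σ″ b → σ″ ≡ σ ∷ʳ b
  step-side (forced _)       = refl
  step-side (left _ _ _ _ _) = refl

  step-ext : Step τ σ τ″ σ″ b → Ext (bit σ) (bit τ) (bit τ″)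
  step-ext (forced _)            = Ext-refl
  step-ext (left τ′ m ext len _) =
    Ext-trans (Ext-weaken (⊆-∷ʳ σ true) ext) (Ext-∷ʳ-true σ τ′ len)

  step-reach : Reach τ σ → Step τ σ τ″ σ″ b → Reach τ″ σ″
  step-reach r (forced forces)       = stay r forces
  step-reach r (left τ′ m ext len _) = exit τ′ m r ext len

  -- A `left` step is impossible here, since its `τ′` is unanswered while `Forces` answers it.
  step-forced : Forces τ σ → Step τ σ τ″ σ″ b → τ ≡ τ″ × σ ∷ʳ true ≡ σ″
  step-forced forces (forced _)              = refl , refl
  step-forced forces (left τ′ _ ext _ ¬ans) = ⊥-elim (¬ans (forces τ′ ext))

  -- After a `forced` step A has no new 1 in column `length σ`, so `exit` cannot fit A. After a
  -- `left` step both strings end with the first new 1 of A in that column; having the same length,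
  -- they are the same part of A.
  step-exit : ∀ {A τ′ m} → Ext (bit σ″) (bit τ″) (bits A) →
              Ext (bit (σ ∷ʳ true)) (bit τ) (bit τ′) → length τ′ ≡ pair (length σ) m →
              Pre (bit (τ′ ∷ʳ true)) (bits A) →
              Step τ σ τ″ σ″ b → τ′ ∷ʳ true ≡ τ″ × σ ∷ʳ false ≡ σ″
  step-exit {A} {τ′} {m} extA ext len pre = go
    where
    A-true : ∀ υ → Pre (bit (υ ∷ʳ true)) (bits A) → bits A (length υ) ≡ 2
    A-true υ p = trans (p _ (λ eq₀ → 1+n≢0 (trans (sym (bit-last υ true)) eq₀))) (bit-last υ true)

    -- As `υ` extends `τ`, position `length υ` lies beyond `τ`, and there `t` has no 1 in column
    -- `length σ`.
    not-before : ∀ υ {t n} → Ext (bit (σ ∷ʳ true)) (bit τ) t → t n ≡ 2 →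
                 Ext (bit (σ ∷ʳ true)) (bit τ) (bit υ) → length υ ≡ n →
                 ∀ {k} → n ≡ pair (length σ) k → ⊥
    not-before υ {t} (_ , avoids) t≡2 (pre′ , _) refl {k} n≡ = avoids (length σ) k (bit-last σ true)
      (bit-beyond τ (subst (length τ ≤_) n≡ (Pre⇒length≤ τ υ pre′)))
      (trans (cong t (sym n≡)) t≡2)

    go : Step τ σ τ″ σ″ b → τ′ ∷ʳ true ≡ τ″ × σ ∷ʳ false ≡ σ″
    go (forced _) = ⊥-elim (not-before τ′ extA (A-true τ′ pre) ext refl len)
    go (left υ k extυ lenυ _) with <-cmp (length τ′) (length υ)
    ... | tri≈ _ eq _ = trans (Pre⇒≺ (τ′ ∷ʳ true) pre)
        (trans (cong (applyUpTo A) (trans (length-∷ʳ τ′ true)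
                                   (trans (cong suc eq) (sym (length-∷ʳ υ true)))))
               (sym (Pre⇒≺ (υ ∷ʳ true) (proj₁ extA)))) , refl
    ... | tri< lt _ _ = ⊥-elim (not-before τ′ extυ
        (trans (sym (Pre-trans (Pre-∷ʳ υ true) (proj₁ extA) _ (bit-within υ lt))) (A-true τ′ pre))
        ext refl len)
    ... | tri> _ _ gt = ⊥-elim (not-before υ ext
        (trans (sym (Pre-trans (Pre-∷ʳ τ′ true) pre _ (bit-within τ′ gt))) (A-true υ (proj₁ extA)))
        extυ refl lenυ)

-- Lets the counterexample in `next` be padded without becoming answered.
Answered-anti : ∀ σ τ τ′ → Ext (bit σ) (bit τ) (bit τ′) → Answered σ τ′ → Answered σ τ
Answered-anti σ τ τ′ ext (τ₂ , υ , ρ , ext₂ , rest) = τ₂ , υ , ρ , Ext-trans ext ext₂ , rest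

module Construction (em : ExcludedMiddle 0ℓ) where
  open Definability em using (functional)

  next : ∀ τ σ → Σ[ τ″ ∈ 2^<ω ] Σ[ σ″ ∈ 2^<ω ] Σ[ b ∈ Bool ] Step τ σ τ″ σ″ b
  next τ σ with em {Σ[ τ₁ ∈ 2^<ω ] (Ext (bit (σ ∷ʳ true)) (bit τ) (bit τ₁) × ¬ Answered σ τ₁)}
  ... | no ¬escape = _ , _ , _ , forced λ τ₁ ext →
    decidable-stable em λ ¬ans → ¬escape (τ₁ , ext , ¬ans)
  ... | yes (τ₁ , ext , ¬ans)
    -- The target is entry `length τ₁` of column `length σ`; by `n≤pair` it does not lie before the
    -- end of `τ₁`.
    with pad {bit (σ ∷ʳ true)} τ₁ (pair (length σ) (length τ₁) ∸ length τ₁)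
  ...   | τ′ , ext′ , len = _ , _ , _ , left τ′ (length τ₁) (Ext-trans ext ext′)
    (trans len (m∸n+n≡m (n≤pair (length σ) (length τ₁))))
    (¬ans ∘ Answered-anti σ τ₁ τ′ (Ext-weaken (⊆-∷ʳ σ true) ext′))

  state : ℕ → 2^<ω × 2^<ω
  state zero    = [] , []
  state (suc k) = let τ″ , σ″ , _ = next (proj₁ (state k)) (proj₂ (state k)) in τ″ , σ″

  stem side : ℕ → 2^<ω
  stem k = proj₁ (state k)
  side k = proj₂ (state k)

  X : 2^ω
  X k = proj₁ (proj₂ (proj₂ (next (stem k) (side k))))

  step : ∀ k → Step (stem k) (side k) (stem (suc k)) (side (suc k)) (X k)
  step k = proj₂ (proj₂ (proj₂ (next (stem k) (side k))))

  -- The stems may stop growing, as `forced` steps add nothing; positions outside all stems get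
  -- `false`.
  A : 2^ω
  A n = does (em {Σ[ k ∈ ℕ ] bit (stem k) n ≡ 2})

  A-true : ∀ {n} k → bit (stem k) n ≡ 2 → bits A n ≡ 2
  A-true {n} k eq with em {Σ[ k ∈ ℕ ] bit (stem k) n ≡ 2}
  ... | yes _ = refl
  ... | no ¬p = ⊥-elim (¬p (k , eq))

  A-false : ∀ {n} → ¬ (Σ[ k ∈ ℕ ] bit (stem k) n ≡ 2) → bits A n ≡ 1
  A-false {n} ¬p with em {Σ[ k ∈ ℕ ] bit (stem k) n ≡ 2}
  ... | yes p = ⊥-elim (¬p p)
  ... | no _  = refl

  A-sound : ∀ {n} → bits A n ≡ 2 → Σ[ k ∈ ℕ ] bit (stem k) n ≡ 2
  A-sound {n} eq with em {Σ[ k ∈ ℕ ] bit (stem k) n ≡ 2}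
  ... | yes p = p
  A-sound {n} () | no _

  side-X : ∀ k → side k ≡ applyUpTo X k
  side-X zero    = refl
  side-X (suc k) = trans (step-side (step k))
    (trans (cong (_∷ʳ X k) (side-X k)) (applyUpTo-∷ʳ X k))

  length-side : ∀ k → length (side k) ≡ k
  length-side k = trans (cong length (side-X k)) (length-applyUpTo X k)

  side-⊆ : ∀ {k j} → k ≤′ j → ∀ i → bit (side k) i ≡ 2 → bit (side j) i ≡ 2
  side-⊆ ≤′-refl         i eq = eq
  side-⊆ (≤′-step {j} p) i eq =
    trans (cong (λ σ → bit σ i) (step-side (step j))) (⊆-∷ʳ (side j) (X j) i (side-⊆ p i eq))

  stem-Ext : ∀ {k j} → k ≤′ j → Ext (bit (side k)) (bit (stem k)) (bit (stem j))
  stem-Ext ≤′-refl         = Ext-refl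
  stem-Ext (≤′-step {j} p) = Ext-trans (stem-Ext p) (Ext-weaken (side-⊆ p) (step-ext (step j)))

  stem-Pre : ∀ {k j} → k ≤ j → Pre (bit (stem k)) (bit (stem j))
  stem-Pre k≤j = proj₁ (stem-Ext (≤⇒≤′ k≤j))

  -- Every 1 of A comes from some stem. A later stem respects the columns of `side k`, and an
  -- earlier one is contained in `stem k`.
  stem-A : ∀ k → Ext (bit (side k)) (bit (stem k)) (bits A)
  stem-A k = pre , avoids
    where
    pre : Pre (bit (stem k)) (bits A)
    pre n ≢0 with bit-true-or-false (stem k) n ≢0
    ... | inj₂ eq = trans (A-true k eq) (sym eq)
    ... | inj₁ eq = trans (A-false λ (j , p) → conflict j p (≤-total k j)) (sym eq)
      where
      conflict : ∀ j → bit (stem j) n ≡ 2 → k ≤ j ⊎ j ≤ k → ⊥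
      conflict j p (inj₁ k≤j) = 1+n≢n (trans (sym p) (trans (stem-Pre k≤j n ≢0) eq))
      conflict j p (inj₂ j≤k) = 1+n≢n (trans (sym p)
        (trans (sym (stem-Pre j≤k n λ eq₀ → 1+n≢0 (trans (sym p) eq₀))) eq))

    avoids : Avoids (bit (side k)) (bit (stem k)) (bits A)
    avoids i m s≡2 t≡0 eq with A-sound eq
    ... | j , p with ≤-total k j
    ...   | inj₁ k≤j = proj₂ (stem-Ext (≤⇒≤′ k≤j)) i m s≡2 t≡0 p
    ...   | inj₂ j≤k = 1+n≢0 (trans (sym p)
      (trans (sym (stem-Pre j≤k _ λ eq₀ → 1+n≢0 (trans (sym p) eq₀))) t≡0))

  -- Computing X from A

  reach-state : ∀ k → Reach (stem k) (side k)
  reach-state zero    = start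
  reach-state (suc k) = step-reach (reach-state k) (step k)

  -- Induction on the derivation: first components only grow, so the earlier pair also fits A and is
  -- a state of the construction. `step-forced` and `step-exit` then identify the next one.
  reach-unique : ∀ {τ σ} → Reach τ σ → Pre (bit τ) (bits A) →
                 Σ[ k ∈ ℕ ] (τ ≡ stem k × σ ≡ side k)
  reach-unique start _ = 0 , refl , refl
  reach-unique (stay r forces) pre with reach-unique r pre
  ... | k , refl , refl = suc k , step-forced forces (step k)
  reach-unique (exit τ′ m r ext len) pre
    with reach-unique r (Pre-trans (Pre-trans (proj₁ ext) (Pre-∷ʳ τ′ true)) pre)
  ... | k , refl , refl = suc k , step-exit (stem-A (suc k)) ext len pre (step k)

  reach⇒X : ∀ {τ σ} → τ ≺ A → Reach τ σ → Σ[ k ∈ ℕ ] σ ≡ applyUpTo X k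
  reach⇒X τ≺A r with reach-unique r (≺⇒Pre τ≺A)
  ... | k , _ , σ≡ = k , trans σ≡ (side-X k)

  functional-A : functional ⟨ A ⟩≐ X
  functional-A = consistent , λ n b → mk⇔ (covers n b) (correct n b)
    where
    consistent : ConsistentOn functional A
    consistent τ τ′ σ σ′ τ≺A τ′≺A r r′ with reach⇒X τ≺A r | reach⇒X τ′≺A r′
    ... | k , refl | k′ , refl = applyUpTo-comparable X k k′

    covers : ∀ n b → X n ≡ b → Σ[ τ ∈ 2^<ω ] Σ[ σ ∈ 2^<ω ] (τ ≺ A × Reach τ σ × σ at n is b)
    covers n b refl = stem (suc n) , side (suc n) , Pre⇒≺ (stem (suc n)) (proj₁ (stem-A (suc n)))
      , reach-state (suc n) , bit⇒at (side (suc n)) n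
          (trans (cong (λ σ → bit σ n) (side-X (suc n))) (bit-↾ X (n<1+n n)))

    correct : ∀ n b → Σ[ τ ∈ 2^<ω ] Σ[ σ ∈ 2^<ω ] (τ ≺ A × Reach τ σ × σ at n is b) → X n ≡ b
    correct n b (τ , σ , τ≺A , r , at) with reach⇒X τ≺A r
    ... | k , refl = val-injective (trans (Pre-↾ X k n (val≢0 b ∘ trans (sym bit≡))) bit≡)
      where
      bit≡ : bit (applyUpTo X k) n ≡ val b
      bit≡ = at⇒bit (applyUpTo X k) at

  -- Diagonalisation against everywhere consistent functionals

  extension : 2^<ω → 2^ω
  extension τ n = does (bit τ n ≟ 2)

  extension-Pre : ∀ τ → Pre (bit τ) (bits (extension τ))
  extension-Pre τ n ≢0 with bit-true-or-false τ n ≢0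
  ... | inj₁ eq rewrite eq = refl
  ... | inj₂ eq rewrite eq = refl

  module _ (Φ : HigherTuringFunctional) (c : ℕ)
           (index : ∀ υ ρ → Universal c (code υ) (code ρ) ⇔ Graph Φ υ ρ) where

    -- Stage `c` defeats the functional of index `c` at argument `c`. The outcome of the step is
    -- kept general to allow case analysis on it.
    diagonal : EverywhereConsistent Φ → UnionIs Φ A X → ∀ {τ″ σ″ b} →
               Ext (bit σ″) (bit τ″) (bits A) → X c ≡ b →
               Step (stem c) (side c) τ″ σ″ b → ⊥
    diagonal consistent union extA Xc (forced forces)
      with to (union c true) Xc
    ... | υ , ρ , υ≺A , graph , ρ-at
      -- This part of A is long enough for both `υ` and the stem. It keeps column `c` empty beyond
      -- the stem because A does so after a `forced` step.
      with forces (applyUpTo A (length υ ⊔ length (stem c)))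
             (Ext-applyUpTo (stem c) (m≤n⊔m (length υ) _) extA)
    ...   | τ₂ , υ′ , ρ′ , (pre , _) , υ′⊑ , ρ′-bit , univ
      -- On `τ₂` followed by zeros, `υ` gives the answer 1 and `υ′` the answer 0, against
      -- consistency.
      with Comparable⇒bits-agree ρ ρ′ {b = true} {b′ = false}
             (consistent (extension τ₂) υ υ′ ρ ρ′ υ≺ext υ′≺ext graph graph′)
             (at⇒bit ρ ρ-at) (trans (cong (bit ρ′) (sym (length-side c))) ρ′-bit)
      where
      υ≺ext : υ ≺ extension τ₂
      υ≺ext = Pre⇒≺ υ (Pre-trans (Pre-trans
        (Pre-applyUpTo (λ i ≢0 → <-≤-trans (bit≢0⇒within υ ≢0) (m≤m⊔n (length υ) _)) (≺⇒Pre υ≺A))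
        pre) (extension-Pre τ₂))

      υ′≺ext : υ′ ≺ extension τ₂
      υ′≺ext = Pre⇒≺ υ′ (Pre-trans υ′⊑ (extension-Pre τ₂))

      graph′ : Graph Φ υ′ ρ′
      graph′ = to (index υ′ ρ′) (subst (λ k → Universal k (code υ′) (code ρ′)) (length-side c) univ)
    ...   | ()
    diagonal consistent union extA Xc (left τ′ m ext len ¬ans)
      with to (union c false) Xc
    -- A part of A containing `υ` and `τ′` would answer `τ′`; its 1 in column `c` is allowed, as
    -- only the columns of `side c` are restricted.
    ... | υ , ρ , υ≺A , graph , ρ-at = ¬ans
      ( applyUpTo A (length υ ⊔ length τ′) , υ , ρ
      , Ext-applyUpTo τ′ (m≤n⊔m (length υ) _)
          (Ext-trans (Ext-∷ʳ-true (side c) τ′ len) (Ext-weaken (⊆-∷ʳ (side c) false) extA))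
      , Pre-applyUpTo (λ i ≢0 → <-≤-trans (bit≢0⇒within υ ≢0) (m≤m⊔n (length υ) _)) (≺⇒Pre υ≺A)
      , trans (cong (bit ρ) (length-side c)) (at⇒bit ρ ρ-at)
      , subst (λ k → Universal k (code υ) (code ρ)) (sym (length-side c)) (from (index υ ρ) graph))

  no-consistent-functional :
    ¬ (Σ[ Φ ∈ HigherTuringFunctional ] (EverywhereConsistent Φ × (Φ ⟨ A ⟩≐ X)))
  no-consistent-functional (Φ , consistent , _ , union) with isΠ¹₁ Φ
  ... | _ , θ , defines = diagonal Φ c index consistent union (stem-A (suc c)) refl (step c)
    where
    open Evaluation em using (universality)
    c = Encoding.formulaᶜ θ

    index : ∀ υ ρ → Universal c (code υ) (code ρ) ⇔ Graph Φ υ ρ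
    index υ ρ = mk⇔ (from (defines υ ρ) ∘ to (universality θ _ _))
                    (from (universality θ _ _) ∘ to (defines υ ρ))

theorem4p1 : ExcludedMiddle 0ℓ →
    Σ[ A ∈ 2^ω ] Σ[ X ∈ 2^ω ]
    ((X ≤ω₁ᶜᵏT A) ×
    ¬ (Σ[ Φ ∈ HigherTuringFunctional ] (EverywhereConsistent Φ × (Φ ⟨ A ⟩≐ X))))
theorem4p1 em = A , X , (Definability.functional em , functional-A) , no-consistent-functional
  where open Construction em
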